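{- There is an algorithm which, given as input two ordered rooted binary trees $S$ and $T$, each with $n$ internal nodes, computes in time $O(n)$ a $2$-approximation of their rotation distance, i.e. a number $A$ satisfying $$d_R(S,T) \;\le\; A \;\le\; 2\, d_R(S,T).$$
   Context: A tree here is an extended binary tree: a finite ordered (plane) rooted binary tree in which every interior (internal) node has exactly two children, a left child and a right child. A tree with $n$ interior nodes has $n+1$ leaves, numbered $1,\dots,n+1$ in left-to-right order. Rotations: write $(X,Y)$ for the tree or subtree whose root has left subtree $X$ and right subtree $Y$. A right rotation at a node whose left child is an interior node replaces the subtree $((A,B),C)$ rooted at that node by $(A,(B,C))$, leaving the rest of the tree unchanged; here $A,B,C$ are arbitrary subtrees (possibly single leaves). A left rotation is the inverse operation, replacing $(A,(B,C))$ by $((A,B),C)$. The rotation distance $d_R(S,T)$ between two trees with the same number of leaves is the minimum number of (left or right) rotations needed to transform $S$ into $T$. Running time is measured in the usual unit-cost random-access machine model (words of $O(\log n)$ bits), with the trees given as standard pointer-based structures. -}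

module Defs where

open import Data.Bool.Base using (if_then_else_)
open import Data.List.Base using (List; []; _∷_; _++_; head; drop)
open import Data.List.Membership.Propositional using (_∉_)
open import Data.List.Relation.Unary.All using (All)
open import Data.List.Relation.Unary.Unique.Propositional using (Unique)
open import Data.Maybe.Base using (Maybe; just; nothing; _>>=_; map)
open import Data.Nat.Base
  using (ℕ; zero; suc; _+_; _*_; _∸_; _/_; _^_; _≤_; _<_; _<ᵇ_; _≡ᵇ_)
open import Data.Nat.Logarithm using (⌈log₂_⌉)
open import Data.Product.Base using (Σ-syntax; _×_)
open import Data.Tree.Binary using (Tree; leaf; node)
open import Data.Unit.Base using (⊤; tt)
open import Relation.Binary.Construct.Closure.Equivalence using (EqClosure)
open import Relation.Binary.Construct.Closure.ReflexiveTransitive using (fold)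
open import Relation.Binary.PropositionalEquality.Core using (_≡_)

------------------------------------------------------------------------
-- Trees and rotation distance

BinTree : Set
BinTree = Tree ⊤ ⊤

pattern ●         = leaf tt
pattern ⟨_,_⟩ l r = node l tt r

private
  variable
    A B C L L′ R R′ S T : BinTree

infix 4 _⟶_ _⟷*_

data _⟶_ : BinTree → BinTree → Set where
  rotate  : ⟨ ⟨ A , B ⟩ , C ⟩ ⟶ ⟨ A , ⟨ B , C ⟩ ⟩
  inLeft  : L ⟶ L′ → ⟨ L , R ⟩ ⟶ ⟨ L′ , R ⟩
  inRight : R ⟶ R′ → ⟨ L , R ⟩ ⟶ ⟨ L , R′ ⟩

-- Each step is a right rotation taken forwards or backwards; the latter
-- is a left rotation.
_⟷*_ : BinTree → BinTree → Set
_⟷*_ = EqClosure _⟶_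

#rotations : S ⟷* T → ℕ
#rotations = fold (λ _ _ → ℕ) (λ _ → suc) 0

IsRotationDistance : BinTree → BinTree → ℕ → Set
IsRotationDistance S T d =
  (Σ[ ρ ∈ S ⟷* T ] #rotations ρ ≡ d) × (∀ (ρ : S ⟷* T) → d ≤ #rotations ρ)

------------------------------------------------------------------------
-- Unit-cost random-access machine with w-bit words

-- Registers are named by natural numbers, but a program mentions only
-- finitely many of them.
Register Address Memory : Set
Register = ℕ
Address  = ℕ
Memory   = Address → ℕ

data ArithOp : Set where
  plus minus times quotient : ArithOp

-- Subtraction is truncated and x / 0 is 0.
apply : ArithOp → ℕ → ℕ → ℕ
apply plus     x y       = x + y
apply minus    x y       = x ∸ y
apply times    x y       = x * y
apply quotient x zero    = 0
apply quotient x (suc y) = x / suc y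

data Instr : Set where
  set   : (r : Register) (x : ℕ) → Instr             -- r := x
  arith : (o : ArithOp) (r s t : Register) → Instr   -- r := s o t
  load  : (r s : Register) → Instr                   -- r := mem[s]
  store : (r s : Register) → Instr                   -- mem[r] := s
  jump  : (ℓ : ℕ) → Instr                            -- goto ℓ
  jzero : (r : Register) (ℓ : ℕ) → Instr             -- if r = 0 goto ℓ
  halt  : Instr                                      -- output register 0

Program : Set
Program = List Instr

fetch : Program → ℕ → Maybe Instr
fetch P i = head (drop i P)

record State : Set where
  constructor state
  field
    pc   : ℕ
    regs : Register → ℕ
    mem  : Memory

_[_↦_] : (ℕ → ℕ) → ℕ → ℕ → (ℕ → ℕ)
(f [ i ↦ x ]) j = if j ≡ᵇ i then x else f j

-- A computed value that needs more than w bits makes the machine fault.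
word : (w : ℕ) → ℕ → Maybe ℕ
word w x = if x <ᵇ 2 ^ w then just x else nothing

branch : ℕ → ℕ → ℕ → ℕ
branch zero    target next = target
branch (suc _) target next = next

-- `halt` has no successor state; its effect is given in `exec`.
step : (w : ℕ) → Instr → State → Maybe State
step w (set r x)       (state i ρ M) =
  map (λ v → state (suc i) (ρ [ r ↦ v ]) M) (word w x)
step w (arith o r s t) (state i ρ M) =
  map (λ v → state (suc i) (ρ [ r ↦ v ]) M) (word w (apply o (ρ s) (ρ t)))
step w (load r s)      (state i ρ M) =
  just (state (suc i) (ρ [ r ↦ M (ρ s) ]) M)
step w (store r s)     (state i ρ M) =
  just (state (suc i) ρ (M [ ρ r ↦ ρ s ]))
step w (jump ℓ)        (state i ρ M) = just (state ℓ ρ M)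
step w (jzero r ℓ)     (state i ρ M) =
  just (state (branch (ρ r) ℓ (suc i)) ρ M)
step w halt            _             = nothing

-- `exec w P t s` is `just x` when P, started in s, halts with output x
-- after at most t instructions (the final `halt` included), and `nothing`
-- when it faults or is still running.
exec : (w : ℕ) → Program → (time : ℕ) → State → Maybe ℕ
dispatch : (w : ℕ) → Program → (time : ℕ) → State → Instr → Maybe ℕ

exec w P zero    s = nothing
exec w P (suc t) s = fetch P (State.pc s) >>= dispatch w P t s

dispatch w P t s halt = just (State.regs s 0)
dispatch w P t s ι    = step w ι s >>= exec w P t

-- O(log n) bits; the offset 3 makes 4n + 1 ≤ 2 ^ wordSize k n, so that the
-- input fits into words whatever k is.
wordSize : (k n : ℕ) → ℕ
wordSize k n = (3 + k) * ⌈log₂ (2 + n) ⌉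

------------------------------------------------------------------------
-- Pointer-based input

-- `Stores M T p as`: in M, p points to the tree T, whose nodes occupy the
-- addresses as.  A leaf is the null pointer 0; an interior node at p has
-- its child pointers in the cells p (left) and p + 1 (right).
data Stores (M : Memory) : BinTree → Address → List Address → Set where
  leaf : Stores M ● 0 []
  node : ∀ {p as bs} → 0 < p →
         Stores M L (M p) as → Stores M R (M (suc p)) bs →
         Stores M ⟨ L , R ⟩ p (p ∷ suc p ∷ as ++ bs)

-- Two trees with n interior nodes each, rooted at p and q, with their 2n
-- nodes in arbitrary order in the cells 1, …, 4n; `Unique` says that no two
-- nodes overlap.  All other cells are initially 0.
record Input (n : ℕ) (S T : BinTree) (M : Memory) (p q : Address) : Set where
  field
    {cellsS cellsT} : List Address
    storesS         : Stores M S p cellsS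
    storesT         : Stores M T q cellsT
    disjoint        : Unique (cellsS ++ cellsT)
    packed          : All (_≤ 4 * n) (cellsS ++ cellsT)
    blank           : ∀ a → a ∉ cellsS ++ cellsT → M a ≡ 0

initialRegs : (n : ℕ) (p q : Address) → Register → ℕ
initialRegs n p q 0 = p
initialRegs n p q 1 = q
initialRegs n p q 2 = n
initialRegs n p q _ = 0

initial : (n : ℕ) (M : Memory) (p q : Address) → State
initial n M p q = state 0 (initialRegs n p q) M

{-# OPTIONS --safe #-}
module Submission where

-- Assign to every interior node the interval of leaf numbers below it.  A
-- rotation changes exactly one interval, so d_R(S,T) is at least the number m
-- of nodes of T whose interval is not an interval of S.  Conversely, rotate
-- away from S every left child whose interval is not common to both trees;
-- this takes at most m rotations, T is treated likewise, and the two resulting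
-- trees coincide.  Hence m ≤ d_R(S,T) ≤ 2 m, and 2 m is the approximation.
--
-- The machine computes m in one traversal of each tree with an explicit
-- stack.  As the memory is blank above the input, a two-dimensional table
-- indexed by intervals needs no initialisation: the traversal of S writes 1
-- into the cells of its intervals, that of T adds up the cells of its own.

open import Defs
open import Data.Bool.Base using (true; false; _∨_; if_then_else_)
open import Data.Bool.Properties using (T-≡)
open import Data.List.Base using (List; []; _∷_; _++_; length; filter; map)
open import Data.List.Membership.Propositional using (_∈_; _∉_; find; lose)
open import Data.List.Membership.Propositional.Properties
  using (∈-++⁺ˡ; ∈-++⁺ʳ; ∈-++⁻; ∈-map⁺; ∈-map⁻; ∈-filter⁺; ∈-filter⁻)
open import Data.List.Membership.Propositional.Properties.WithK using (unique∧set⇒bag)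
open import Data.List.Properties using (filter-++; filter-none; length-++; ++-assoc; ++-identityʳ)
open import Data.List.Relation.Binary.BagAndSetEquality using (∼bag⇒↭)
open import Data.List.Relation.Binary.Permutation.Propositional.Properties using (↭-length)
open import Data.List.Relation.Unary.All as All using (All; []; _∷_)
import Data.List.Relation.Unary.All.Properties as All
open import Data.List.Relation.Unary.Any using (Any; here; there; any?)
open import Data.List.Relation.Unary.Unique.Propositional using (Unique; []; _∷_)
import Data.List.Relation.Unary.Unique.Propositional.Properties as Unique
open import Data.Maybe.Base as Maybe using (just; nothing; _>>=_)
open import Data.Nat.Base hiding (_/_; _%_)
open import Data.Nat.DivMod using (_%_; [m+kn]%n≡m%n; m<n⇒m%n≡m)
open import Data.Nat.Induction using (<-wellFounded)
open import Data.Nat.Logarithm using (⌈log₂_⌉)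
open import Data.Nat.Logarithm.Core using (⌈log2⌉)
open import Data.Nat.Properties
open import Data.Nat.Tactic.RingSolver using (solve-∀)
open import Data.Product.Base using (Σ-syntax; ∃-syntax; ∃₂; _×_; _,_; proj₁; proj₂)
import Data.Product.Properties as Product
open import Data.Sum.Base using (_⊎_; inj₁; inj₂)
open import Data.Tree.Binary using (#nodes; #leaves)
open import Function.Base using (_∘_; case_of_)
open import Function.Bundles using (mk⇔; Equivalence)
open import Induction.WellFounded using (Acc; acc)
open import Level using (0ℓ)
open import Relation.Binary.Construct.Closure.Equivalence as Eq using ()
open import Relation.Binary.Construct.Closure.ReflexiveTransitive using (ε; _◅_; _◅◅_)
open import Relation.Binary.Construct.Closure.Symmetric as Sym using (fwd; bwd)
open import Relation.Binary.Definitions using (DecidableEquality)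
open import Relation.Binary.PropositionalEquality
open import Relation.Nullary.Decidable
  using (Dec; yes; no; ¬?; map′; _×-dec_; does; dec-true; dec-false)
open import Relation.Nullary.Negation using (¬_; contradiction)
open import Relation.Unary using (Pred; Decidable)

-- Numbers of leaves and nodes

#leaves≡1+#nodes : (T : BinTree) → #leaves T ≡ suc (#nodes T)
#leaves≡1+#nodes ●         = refl
#leaves≡1+#nodes ⟨ L , R ⟩ =
  cong₂ _+_ (#leaves≡1+#nodes L) (#leaves≡1+#nodes R)

0<#leaves : (T : BinTree) → 0 < #leaves T
0<#leaves T rewrite #leaves≡1+#nodes T = s≤s z≤n

-- Rotation paths

infix 4 _⟷[≤_]_ _≟ᵀ_

_⟷[≤_]_ : BinTree → ℕ → BinTree → Set
S ⟷[≤ k ] T = Σ[ ρ ∈ S ⟷* T ] #rotations ρ ≤ k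

#rotations-◅◅ : ∀ {S T U} (ρ : S ⟷* T) (σ : T ⟷* U) →
                #rotations (ρ ◅◅ σ) ≡ #rotations ρ + #rotations σ
#rotations-◅◅ ε       σ = refl
#rotations-◅◅ (x ◅ ρ) σ = cong suc (#rotations-◅◅ ρ σ)

path-refl : ∀ {S k} → S ⟷[≤ k ] S
path-refl = ε , z≤n

path-trans : ∀ {S T U j k} → S ⟷[≤ j ] T → T ⟷[≤ k ] U → S ⟷[≤ j + k ] U
path-trans (ρ , p) (σ , q) = ρ ◅◅ σ ,
  ≤-trans (≤-reflexive (#rotations-◅◅ ρ σ)) (+-mono-≤ p q)

path-weaken : ∀ {S T j k} → j ≤ k → S ⟷[≤ j ] T → S ⟷[≤ k ] T
path-weaken j≤k (ρ , p) = ρ , ≤-trans p j≤k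

path-sym : ∀ {S T k} → S ⟷[≤ k ] T → T ⟷[≤ k ] S
path-sym             (ε     , _)     = path-refl
path-sym {k = suc k} (x ◅ ρ , s≤s p) =
  path-weaken (≤-reflexive (+-comm k 1))
    (path-trans (path-sym (ρ , p)) (Sym.symmetric _⟶_ x ◅ ε , s≤s z≤n))

path-map : (f : BinTree → BinTree) → (∀ {S T} → S ⟶ T → f S ⟶ f T) →
           ∀ {S T k} → S ⟷[≤ k ] T → f S ⟷[≤ k ] f T
path-map f f⟶ (ρ , p) = Eq.gmap f f⟶ ρ , ≤-trans (≤-reflexive (go ρ)) p
  where
  go : ∀ {S T} (ρ : S ⟷* T) → #rotations (Eq.gmap f f⟶ ρ) ≡ #rotations ρ
  go ε       = refl
  go (x ◅ ρ) = cong suc (go ρ)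

path-left : ∀ {L L′ R k} → L ⟷[≤ k ] L′ → ⟨ L , R ⟩ ⟷[≤ k ] ⟨ L′ , R ⟩
path-left = path-map ⟨_, _ ⟩ inLeft

path-right : ∀ {L R R′ k} → R ⟷[≤ k ] R′ → ⟨ L , R ⟩ ⟷[≤ k ] ⟨ L , R′ ⟩
path-right = path-map ⟨ _ ,_⟩ inRight

-- Existence of the rotation distance

_≟ᵀ_ : DecidableEquality BinTree
●         ≟ᵀ ●           = yes refl
●         ≟ᵀ ⟨ _ , _ ⟩   = no λ ()
⟨ _ , _ ⟩ ≟ᵀ ●           = no λ ()
⟨ L , R ⟩ ≟ᵀ ⟨ L′ , R′ ⟩ =
  map′ (λ { (refl , refl) → refl }) (λ { refl → refl , refl })
       ((L ≟ᵀ L′) ×-dec (R ≟ᵀ R′))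

rotationsʳ rotationsˡ : BinTree → List BinTree

rotateʳ rotateˡ : BinTree → BinTree → List BinTree
rotateʳ ●         C = []
rotateʳ ⟨ A , B ⟩ C = ⟨ A , ⟨ B , C ⟩ ⟩ ∷ []
rotateˡ A ●         = []
rotateˡ A ⟨ B , C ⟩ = ⟨ ⟨ A , B ⟩ , C ⟩ ∷ []

rotationsʳ ●         = []
rotationsʳ ⟨ L , R ⟩ =
  rotateʳ L R ++ map ⟨_, R ⟩ (rotationsʳ L) ++ map ⟨ L ,_⟩ (rotationsʳ R)

rotationsˡ ●         = []
rotationsˡ ⟨ L , R ⟩ =
  rotateˡ L R ++ map ⟨_, R ⟩ (rotationsˡ L) ++ map ⟨ L ,_⟩ (rotationsˡ R)

rotationsʳ-complete : ∀ {S T} → S ⟶ T → T ∈ rotationsʳ S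
rotationsʳ-complete rotate = here refl
rotationsʳ-complete (inLeft {L} {R = R} r) =
  ∈-++⁺ʳ (rotateʳ L R) (∈-++⁺ˡ (∈-map⁺ ⟨_, R ⟩ (rotationsʳ-complete r)))
rotationsʳ-complete (inRight {R} {L = L} r) =
  ∈-++⁺ʳ (rotateʳ L R)
    (∈-++⁺ʳ (map ⟨_, R ⟩ (rotationsʳ L)) (∈-map⁺ ⟨ L ,_⟩ (rotationsʳ-complete r)))

rotationsˡ-complete : ∀ {S T} → S ⟶ T → S ∈ rotationsˡ T
rotationsˡ-complete rotate = here refl
rotationsˡ-complete (inLeft {L′ = L} {R = R} r) =
  ∈-++⁺ʳ (rotateˡ L R) (∈-++⁺ˡ (∈-map⁺ ⟨_, R ⟩ (rotationsˡ-complete r)))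
rotationsˡ-complete (inRight {R′ = R} {L = L} r) =
  ∈-++⁺ʳ (rotateˡ L R)
    (∈-++⁺ʳ (map ⟨_, R ⟩ (rotationsˡ L)) (∈-map⁺ ⟨ L ,_⟩ (rotationsˡ-complete r)))

rotationsʳ-sound : ∀ S {T} → T ∈ rotationsʳ S → S ⟶ T
rotationsʳ-sound ⟨ L , R ⟩ m with ∈-++⁻ (rotateʳ L R) m
rotationsʳ-sound ⟨ ⟨ A , B ⟩ , R ⟩ m | inj₁ (here refl) = rotate
... | inj₂ m′ with ∈-++⁻ (map ⟨_, R ⟩ (rotationsʳ L)) m′
...   | inj₁ l with _ , l′ , refl ← ∈-map⁻ ⟨_, R ⟩ l = inLeft (rotationsʳ-sound L l′)
...   | inj₂ r with _ , r′ , refl ← ∈-map⁻ ⟨ L ,_⟩ r = inRight (rotationsʳ-sound R r′)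

rotationsˡ-sound : ∀ T {S} → S ∈ rotationsˡ T → S ⟶ T
rotationsˡ-sound ⟨ L , R ⟩ m with ∈-++⁻ (rotateˡ L R) m
rotationsˡ-sound ⟨ L , ⟨ B , C ⟩ ⟩ m | inj₁ (here refl) = rotate
... | inj₂ m′ with ∈-++⁻ (map ⟨_, R ⟩ (rotationsˡ L)) m′
...   | inj₁ l with _ , l′ , refl ← ∈-map⁻ ⟨_, R ⟩ l = inLeft (rotationsˡ-sound L l′)
...   | inj₂ r with _ , r′ , refl ← ∈-map⁻ ⟨ L ,_⟩ r = inRight (rotationsˡ-sound R r′)

-- A tree has only finitely many neighbours, listed by `rotationsʳ` and `rotationsˡ`, so the first
-- step of a path can be searched exhaustively.
path? : ∀ k S T → Dec (Σ[ ρ ∈ S ⟷* T ] #rotations ρ ≡ k)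
path? zero    S T =
  map′ (λ { refl → ε , refl }) (λ { (ε , refl) → refl }) (S ≟ᵀ T)
path? (suc k) S T =
  map′ sound complete (any? (λ U → path? k U T) (rotationsʳ S ++ rotationsˡ S))
  where
  sound : Any (λ U → Σ[ ρ ∈ U ⟷* T ] #rotations ρ ≡ k) (rotationsʳ S ++ rotationsˡ S) →
          Σ[ ρ ∈ S ⟷* T ] #rotations ρ ≡ suc k
  sound a with find a
  ... | _ , m , ρ , refl with ∈-++⁻ (rotationsʳ S) m
  ...   | inj₁ r = fwd (rotationsʳ-sound S r) ◅ ρ , refl
  ...   | inj₂ l = bwd (rotationsˡ-sound S l) ◅ ρ , refl
  complete : Σ[ ρ ∈ S ⟷* T ] #rotations ρ ≡ suc k →
             Any (λ U → Σ[ ρ ∈ U ⟷* T ] #rotations ρ ≡ k) (rotationsʳ S ++ rotationsˡ S)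
  complete (fwd r ◅ ρ , refl) = lose (∈-++⁺ˡ (rotationsʳ-complete r)) (ρ , refl)
  complete (bwd r ◅ ρ , refl) =
    lose (∈-++⁺ʳ (rotationsʳ S) (rotationsˡ-complete r)) (ρ , refl)

least : {P : ℕ → Set} → (∀ k → Dec (P k)) → ∀ k → P k →
        ∃[ d ] (P d × (∀ j → P j → d ≤ j))
least P? k pk with P? 0
least P? k       pk | yes p0 = 0 , p0 , λ _ _ → z≤n
least P? zero    pk | no ¬p0 = contradiction pk ¬p0
least P? (suc k) pk | no ¬p0 with least (λ j → P? (suc j)) k pk
... | d , pd , min = suc d , pd , λ where
  zero    p0 → contradiction p0 ¬p0
  (suc j) pj → s≤s (min j pj)

-- Paths of each exact length are decidable, so the given path `ρ` bounds a search for the least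
-- length.
rotationDistance : ∀ {S T} → S ⟷* T → ∃[ d ] IsRotationDistance S T d
rotationDistance {S} {T} ρ with least (λ k → path? k S T) (#rotations ρ) (ρ , refl)
... | d , shortest , min = d , shortest , λ σ → min (#rotations σ) (σ , refl)

-- Leaf intervals

Span : Set
Span = ℕ × ℕ

_≟ˢ_ : DecidableEquality Span
_≟ˢ_ = Product.≡-dec _≟_ _≟_

open import Data.List.Membership.DecPropositional _≟ˢ_ using (_∈?_)

-- A node whose leaves are numbered a, …, b - 1 has span (a , b); the leaves
-- of the tree are numbered from i on.
spans : ℕ → BinTree → List Span
spans i ●         = []
spans i ⟨ L , R ⟩ =
  (i , i + #leaves ⟨ L , R ⟩) ∷ spans (i + #leaves L) R ++ spans i L

module _ {i : ℕ} {L R : BinTree} {z : Span} where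

  ∈-spans⁻ : z ∈ spans i ⟨ L , R ⟩ →
             z ≡ (i , i + #leaves ⟨ L , R ⟩) ⊎
             z ∈ spans i L ⊎ z ∈ spans (i + #leaves L) R
  ∈-spans⁻ (here eq) = inj₁ eq
  ∈-spans⁻ (there m) with ∈-++⁻ (spans (i + #leaves L) R) m
  ... | inj₁ r = inj₂ (inj₂ r)
  ... | inj₂ l = inj₂ (inj₁ l)

  ∈-spans⁺ˡ : z ∈ spans i L → z ∈ spans i ⟨ L , R ⟩
  ∈-spans⁺ˡ m = there (∈-++⁺ʳ (spans (i + #leaves L) R) m)

  ∈-spans⁺ʳ : z ∈ spans (i + #leaves L) R → z ∈ spans i ⟨ L , R ⟩
  ∈-spans⁺ʳ m = there (∈-++⁺ˡ m)

length-spans : ∀ i T → length (spans i T) ≡ #nodes T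
length-spans i ●         = refl
length-spans i ⟨ L , R ⟩ = begin
  suc (length (spans (i + #leaves L) R ++ spans i L))
    ≡⟨ cong suc (length-++ (spans (i + #leaves L) R)) ⟩
  suc (length (spans (i + #leaves L) R) + length (spans i L))
    ≡⟨ cong suc (cong₂ _+_ (length-spans (i + #leaves L) R) (length-spans i L)) ⟩
  suc (#nodes R + #nodes L)
    ≡⟨ +-comm (suc (#nodes R)) (#nodes L) ⟩
  #nodes L + suc (#nodes R) ∎
  where open ≡-Reasoning

spans-range : ∀ i T {a b} → (a , b) ∈ spans i T → i ≤ a × a < b × b ≤ i + #leaves T
spans-range i T@(⟨ L , R ⟩) m with ∈-spans⁻ {i} {L} {R} m
... | inj₁ refl = ≤-refl , m<m+n i (0<#leaves T) , ≤-refl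
... | inj₂ (inj₁ l) with spans-range i L l
...   | p , q , r = p , q , ≤-trans r (+-monoʳ-≤ i (m≤m+n (#leaves L) (#leaves R)))
spans-range i T@(⟨ L , R ⟩) m | inj₂ (inj₂ r) with spans-range (i + #leaves L) R r
... | p , q , s = m+n≤o⇒m≤o i p , q , ≤-trans s (≤-reflexive (+-assoc i (#leaves L) (#leaves R)))

-- The root's span starts before every span of `R` and ends after every span of `L`; spans of `L`
-- and `R` are nonempty and separated by the split position.
spans-unique : ∀ i T → Unique (spans i T)
spans-unique i ●         = []
spans-unique i T@(⟨ L , R ⟩) =
  All.tabulate (λ m eq → root∉ (subst (_∈ _) (sym eq) m))
  ∷ Unique.++⁺ (spans-unique (i + #leaves L) R) (spans-unique i L) disjoint
  where
  disjoint : ∀ {z} → ¬ (z ∈ spans (i + #leaves L) R × z ∈ spans i L)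
  disjoint (r , l) with spans-range (i + #leaves L) R r | spans-range i L l
  ... | i+l≤a , _ | _ , a<b , b≤i+l = <-irrefl refl (<-≤-trans a<b (≤-trans b≤i+l i+l≤a))
  root∉ : (i , i + #leaves T) ∉ spans (i + #leaves L) R ++ spans i L
  root∉ m with ∈-++⁻ (spans (i + #leaves L) R) m
  ... | inj₁ r = <⇒≱ (m<m+n i (0<#leaves L)) (proj₁ (spans-range (i + #leaves L) R r))
  ... | inj₂ l = <⇒≱ (m<m+n (#leaves L) (0<#leaves R))
                   (+-cancelˡ-≤ i _ _ (proj₂ (proj₂ (spans-range i L l))))

-- Effect of a rotation on the spans

#leaves-⟶ : ∀ {S T} → S ⟶ T → #leaves S ≡ #leaves T
#leaves-⟶ (rotate {A} {B} {C}) = +-assoc (#leaves A) (#leaves B) (#leaves C)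
#leaves-⟶ (inLeft {R = R} r)   = cong (_+ #leaves R) (#leaves-⟶ r)
#leaves-⟶ (inRight {L = L} r)  = cong (#leaves L +_) (#leaves-⟶ r)

infix 4 _⊆[+1]_

-- The exceptional span is chosen before `z`. A list without duplicates contains it at most once,
-- which is what limits the loss caused by a rotation to one.
_⊆[+1]_ : List Span → List Span → Set
xs ⊆[+1] ys = ∃[ x ] (∀ {z} → z ∈ xs → z ≡ x ⊎ z ∈ ys)

⊆[+1]-left : ∀ {i L L′} R → #leaves L ≡ #leaves L′ →
  spans i L ⊆[+1] spans i L′ → spans i ⟨ L , R ⟩ ⊆[+1] spans i ⟨ L′ , R ⟩
⊆[+1]-left {i} {L} {L′} R eq (x , sub) = x , go
  where
  go : ∀ {z} → z ∈ spans i ⟨ L , R ⟩ → z ≡ x ⊎ z ∈ spans i ⟨ L′ , R ⟩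
  go m with ∈-spans⁻ {i} {L} {R} m
  ... | inj₁ refl rewrite eq = inj₂ (here refl)
  ... | inj₂ (inj₂ r) rewrite eq = inj₂ (∈-spans⁺ʳ {i} {L′} {R} r)
  ... | inj₂ (inj₁ l) with sub l
  ...   | inj₁ z≡x = inj₁ z≡x
  ...   | inj₂ l′  = inj₂ (∈-spans⁺ˡ {i} {L′} {R} l′)

⊆[+1]-right : ∀ {i R R′} L → #leaves R ≡ #leaves R′ →
  spans (i + #leaves L) R ⊆[+1] spans (i + #leaves L) R′ →
  spans i ⟨ L , R ⟩ ⊆[+1] spans i ⟨ L , R′ ⟩
⊆[+1]-right {i} {R} {R′} L eq (x , sub) = x , go
  where
  go : ∀ {z} → z ∈ spans i ⟨ L , R ⟩ → z ≡ x ⊎ z ∈ spans i ⟨ L , R′ ⟩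
  go m with ∈-spans⁻ {i} {L} {R} m
  ... | inj₁ refl rewrite eq = inj₂ (here refl)
  ... | inj₂ (inj₁ l) = inj₂ (∈-spans⁺ˡ {i} {L} {R′} l)
  ... | inj₂ (inj₂ r) with sub r
  ...   | inj₁ z≡x = inj₁ z≡x
  ...   | inj₂ r′  = inj₂ (∈-spans⁺ʳ {i} {L} {R′} r′)

module _ (i : ℕ) (A B C : BinTree) where

  private
    a = #leaves A
    b = #leaves B
    c = #leaves C

  -- The root and the nodes inside `A`, `B` and `C` keep their spans, up to associativity of
  -- addition. Only the inner node changes: the exception is the span of `⟨ A , B ⟩` here and that
  -- of `⟨ B , C ⟩` in `⊆[+1]-unrotate`.
  ⊆[+1]-rotate : spans i ⟨ ⟨ A , B ⟩ , C ⟩ ⊆[+1] spans i ⟨ A , ⟨ B , C ⟩ ⟩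
  ⊆[+1]-rotate = (i , i + (a + b)) , go
    where
    go : ∀ {z} → z ∈ spans i ⟨ ⟨ A , B ⟩ , C ⟩ →
         z ≡ (i , i + (a + b)) ⊎ z ∈ spans i ⟨ A , ⟨ B , C ⟩ ⟩
    go m with ∈-spans⁻ {i} {⟨ A , B ⟩} {C} m
    ... | inj₁ refl rewrite +-assoc a b c = inj₂ (here refl)
    ... | inj₂ (inj₂ z∈C) rewrite sym (+-assoc i a b) =
      inj₂ (∈-spans⁺ʳ {i} {A} {⟨ B , C ⟩} (∈-spans⁺ʳ {i + a} {B} {C} z∈C))
    ... | inj₂ (inj₁ m′) with ∈-spans⁻ {i} {A} {B} m′
    ...   | inj₁ eq          = inj₁ eq
    ...   | inj₂ (inj₁ z∈A) = inj₂ (∈-spans⁺ˡ {i} {A} {⟨ B , C ⟩} z∈A)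
    ...   | inj₂ (inj₂ z∈B) =
      inj₂ (∈-spans⁺ʳ {i} {A} {⟨ B , C ⟩} (∈-spans⁺ˡ {i + a} {B} {C} z∈B))

  ⊆[+1]-unrotate : spans i ⟨ A , ⟨ B , C ⟩ ⟩ ⊆[+1] spans i ⟨ ⟨ A , B ⟩ , C ⟩
  ⊆[+1]-unrotate = (i + a , i + a + (b + c)) , go
    where
    go : ∀ {z} → z ∈ spans i ⟨ A , ⟨ B , C ⟩ ⟩ →
         z ≡ (i + a , i + a + (b + c)) ⊎ z ∈ spans i ⟨ ⟨ A , B ⟩ , C ⟩
    go m with ∈-spans⁻ {i} {A} {⟨ B , C ⟩} m
    ... | inj₁ refl rewrite +-assoc a b c = inj₂ (here refl)
    ... | inj₂ (inj₁ z∈A) =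
      inj₂ (∈-spans⁺ˡ {i} {⟨ A , B ⟩} {C} (∈-spans⁺ˡ {i} {A} {B} z∈A))
    ... | inj₂ (inj₂ m′) with ∈-spans⁻ {i + a} {B} {C} m′
    ...   | inj₁ eq         = inj₁ eq
    ...   | inj₂ (inj₁ z∈B) =
      inj₂ (∈-spans⁺ˡ {i} {⟨ A , B ⟩} {C} (∈-spans⁺ʳ {i} {A} {B} z∈B))
    ...   | inj₂ (inj₂ z∈C) rewrite +-assoc i a b =
      inj₂ (∈-spans⁺ʳ {i} {⟨ A , B ⟩} {C} z∈C)

⟶-⊆[+1] : ∀ i {S T} → S ⟶ T → spans i S ⊆[+1] spans i T
⟶-⊆[+1] i (rotate {A} {B} {C}) = ⊆[+1]-rotate i A B C
⟶-⊆[+1] i (inLeft {R = R} r)   = ⊆[+1]-left R (#leaves-⟶ r) (⟶-⊆[+1] i r)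
⟶-⊆[+1] i (inRight {L = L} r)  = ⊆[+1]-right L (#leaves-⟶ r) (⟶-⊆[+1] _ r)

⟶-⊇[+1] : ∀ i {S T} → S ⟶ T → spans i T ⊆[+1] spans i S
⟶-⊇[+1] i (rotate {A} {B} {C}) = ⊆[+1]-unrotate i A B C
⟶-⊇[+1] i (inLeft {R = R} r)   = ⊆[+1]-left R (sym (#leaves-⟶ r)) (⟶-⊇[+1] i r)
⟶-⊇[+1] i (inRight {L = L} r)  = ⊆[+1]-right L (sym (#leaves-⟶ r)) (⟶-⊇[+1] _ r)

-- Lost spans and the lower bound

#kept #lost : {K : Pred Span 0ℓ} → Decidable K → List Span → ℕ
#kept K? = length ∘ filter K?
#lost K? = length ∘ filter (¬? ∘ K?)

#lost-++ : ∀ {K : Pred Span 0ℓ} (K? : Decidable K) xs ys →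
           #lost K? (xs ++ ys) ≡ #lost K? xs + #lost K? ys
#lost-++ K? xs ys =
  trans (cong length (filter-++ (¬? ∘ K?) xs ys)) (length-++ (filter (¬? ∘ K?) xs))

#kept+#lost : ∀ {K : Pred Span 0ℓ} (K? : Decidable K) xs →
              #kept K? xs + #lost K? xs ≡ length xs
#kept+#lost K? []       = refl
#kept+#lost K? (x ∷ xs) with K? x
... | yes _ = cong suc (#kept+#lost K? xs)
... | no  _ = trans (+-suc _ _) (cong suc (#kept+#lost K? xs))

#lost-mono : ∀ {K K′ : Pred Span 0ℓ} (K? : Decidable K) (K′? : Decidable K′) ys →
             (∀ {z} → z ∈ ys → K z → K′ z) → #lost K′? ys ≤ #lost K? ys
#lost-mono K? K′? []       sub = z≤n
#lost-mono K? K′? (y ∷ ys) sub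
  with ih ← #lost-mono K? K′? ys (sub ∘ there) | K′? y | K? y
... | yes _  | yes _ = ih
... | yes _  | no _  = m≤n⇒m≤1+n ih
... | no ¬k′ | yes k = contradiction (sub (here refl) k) ¬k′
... | no _   | no _  = s≤s ih

-- The first `y` that is in `xs` but not in `xs′` must be the exceptional span. By uniqueness it
-- does not recur, so the rest of `ys` is subject to a plain inclusion and `#lost-mono` applies.
#lost-step : ∀ {xs xs′ ys} → Unique ys → xs ⊆[+1] xs′ →
             #lost (_∈? xs′) ys ≤ suc (#lost (_∈? xs) ys)
#lost-step []       sub = z≤n
#lost-step {xs} {xs′} {y ∷ ys} (y∉ys ∷ u) (x , sub)
  with ih ← #lost-step {xs} {xs′} u (x , sub) | y ∈? xs′ | y ∈? xs
... | yes _    | yes _    = ih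
... | yes _    | no _     = m≤n⇒m≤1+n ih
... | no _     | no _     = s≤s ih
... | no y∉xs′ | yes y∈xs with sub y∈xs
...   | inj₂ y∈xs′ = contradiction y∈xs′ y∉xs′
...   | inj₁ refl  = s≤s (#lost-mono (_∈? xs) (_∈? xs′) ys λ z∈ys z∈xs → stays z∈ys (sub z∈xs))
  where
  stays : ∀ {z} → z ∈ ys → z ≡ y ⊎ z ∈ xs′ → z ∈ xs′
  stays z∈ys (inj₁ refl) = contradiction refl (All.lookup y∉ys z∈ys)
  stays z∈ys (inj₂ z∈xs′) = z∈xs′

-- Both filtered lists enumerate the intersection without repetition, hence are permutations of each
-- other.
#kept-sym : ∀ {xs ys} → Unique xs → Unique ys → #kept (_∈? xs) ys ≡ #kept (_∈? ys) xs
#kept-sym {xs} {ys} ux uy =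
  ↭-length (∼bag⇒↭ (unique∧set⇒bag (Unique.filter⁺ (_∈? xs) uy) (Unique.filter⁺ (_∈? ys) ux)
    (mk⇔ (flip-∈ {xs} {ys}) (flip-∈ {ys} {xs}))))
  where
  flip-∈ : ∀ {xs ys z} → z ∈ filter (_∈? xs) ys → z ∈ filter (_∈? ys) xs
  flip-∈ {xs} {ys} m with ∈-filter⁻ (_∈? xs) {xs = ys} m
  ... | z∈ys , z∈xs = ∈-filter⁺ (_∈? ys) z∈xs z∈ys

-- Along the path towards `T`, each rotation lowers the number of spans of `T` missing from the
-- current tree by at most one, and at `T` itself none is missing.
#rotations-≥ : ∀ i {S T} (ρ : S ⟷* T) →
               #lost (_∈? spans i S) (spans i T) ≤ #rotations ρ
#rotations-≥ i {T = T} ε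
  rewrite filter-none (λ z → ¬? (z ∈? spans i T))
            (All.tabulate {xs = spans i T} λ z∈ z∉ → z∉ z∈) = z≤n
#rotations-≥ i {T = T} (fwd r ◅ ρ) =
  ≤-trans (#lost-step (spans-unique i T) (⟶-⊇[+1] i r)) (s≤s (#rotations-≥ i ρ))
#rotations-≥ i {T = T} (bwd r ◅ ρ) =
  ≤-trans (#lost-step (spans-unique i T) (⟶-⊆[+1] i r)) (s≤s (#rotations-≥ i ρ))

-- Normal forms relative to a set of kept spans

module Normalisation {K : Pred Span 0ℓ} (K? : Decidable K) where

  -- `attach i X Z` is a rotated ⟨ X , Z ⟩: X is dissolved along its left
  -- spine until a leaf or a subtree with span in K is reached.
  normalise : ℕ → BinTree → BinTree
  attach    : ℕ → BinTree → BinTree → BinTree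

  normalise i ●         = ●
  normalise i ⟨ A , B ⟩ = attach i A (normalise (i + #leaves A) B)

  attach i ●             Z = ⟨ ● , Z ⟩
  attach i X@(⟨ A , B ⟩) Z with K? (i , i + #leaves X)
  -- The left child is `normalise i X` unfolded, so that every recursive call is on `A` or `B`.
  ... | yes _ = ⟨ attach i A (normalise (i + #leaves A) B) , Z ⟩
  ... | no  _ = attach i A (attach (i + #leaves A) B Z)

  #leaves-normalise : ∀ i X → #leaves (normalise i X) ≡ #leaves X
  #leaves-attach    : ∀ i X Z → #leaves (attach i X Z) ≡ #leaves X + #leaves Z

  #leaves-normalise i ●         = refl
  #leaves-normalise i ⟨ A , B ⟩ =
    trans (#leaves-attach i A _) (cong (#leaves A +_) (#leaves-normalise _ B))

  #leaves-attach i ●             Z = refl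
  #leaves-attach i X@(⟨ A , B ⟩) Z with #leaves-normalise i X | K? (i , i + #leaves X)
  ... | eq | yes _ = cong (_+ #leaves Z) eq
  ... | _  | no  _ = begin
    #leaves (attach i A (attach (i + #leaves A) B Z))
      ≡⟨ #leaves-attach i A _ ⟩
    #leaves A + #leaves (attach (i + #leaves A) B Z)
      ≡⟨ cong (#leaves A +_) (#leaves-attach _ B Z) ⟩
    #leaves A + (#leaves B + #leaves Z)
      ≡⟨ +-assoc (#leaves A) _ _ ⟨
    #leaves X + #leaves Z ∎
    where open ≡-Reasoning

  private
    cost : ℕ → BinTree → ℕ
    cost i X = #lost K? (spans i X)

    -- `normalise` rotates only nodes below the root, so it is charged for the two subtrees alone;
    -- the inequality is strict when the root's span is outside `K`.
    cost-split : ∀ i A B → cost (i + #leaves A) B + cost i A ≤ cost i ⟨ A , B ⟩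
    cost-split i A B with K? (i , i + #leaves ⟨ A , B ⟩)
    ... | yes _ = ≤-reflexive (sym (#lost-++ K? (spans (i + #leaves A) B) _))
    ... | no  _ = m≤n⇒m≤1+n (≤-reflexive (sym (#lost-++ K? (spans (i + #leaves A) B) _)))

  -- Every rotation made removes one left child whose span is outside `K`, and that span pays for
  -- it. In `attach-path` the tree `Z` is only carried along, so the bound mentions `X` alone.
  normalise-path : ∀ i X → X ⟷[≤ #lost K? (spans i X) ] normalise i X
  attach-path    : ∀ i X Z → ⟨ X , Z ⟩ ⟷[≤ #lost K? (spans i X) ] attach i X Z

  normalise-path i ●         = path-refl
  normalise-path i ⟨ A , B ⟩ = path-weaken (cost-split i A B)
    (path-trans (path-right (normalise-path _ B)) (attach-path i A _))

  attach-path i ●             Z = path-refl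
  attach-path i X@(⟨ A , B ⟩) Z with K? (i , i + #leaves X) | normalise-path i X
  ... | yes _ | nX = path-left nX
  ... | no _  | _  = path-weaken
    (≤-reflexive (cong suc (sym (#lost-++ K? (spans (i + #leaves A) B) _))))
    -- The single rotation is charged to the span of `X` itself, the `suc` in the cost.
    (path-trans {j = 1} (fwd rotate ◅ ε , ≤-refl)
      (path-trans (path-right (attach-path _ B Z)) (attach-path i A _)))

  -- Turning `⟨ ⟨ A , B ⟩ , Z ⟩` into `⟨ A , ⟨ B , Z ⟩ ⟩` destroys only the span of `⟨ A , B ⟩`, and
  -- `attach` does so only if that span is outside `K`. `attach-root` supplies the case of the root.
  normalise-keeps : ∀ i X {z} → K z → z ∈ spans i X → z ∈ spans i (normalise i X)
  attach-keeps    : ∀ i X Z {z} → K z →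
                    z ∈ spans i X ⊎ z ∈ spans (i + #leaves X) Z →
                    z ∈ spans i (attach i X Z)
  attach-root     : ∀ i X Z → (i , i + (#leaves X + #leaves Z)) ∈ spans i (attach i X Z)

  normalise-keeps i X@(⟨ A , B ⟩) k m with ∈-spans⁻ {i} {A} {B} m
  ... | inj₂ (inj₁ l) = attach-keeps i A _ k (inj₁ l)
  ... | inj₂ (inj₂ r) = attach-keeps i A _ k (inj₂ (normalise-keeps _ B k r))
  ... | inj₁ refl     =
    subst (λ b → (i , i + (#leaves A + b)) ∈ spans i (normalise i X)) (#leaves-normalise _ B)
      (attach-root i A (normalise (i + #leaves A) B))

  attach-keeps i ●             Z k (inj₂ m) = ∈-spans⁺ʳ {i} {●} {Z} m
  attach-keeps i X@(⟨ A , B ⟩) Z {z} k m with normalise-keeps i X {z} k | K? (i , i + #leaves X)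
  attach-keeps i X@(⟨ A , B ⟩) Z k (inj₁ m) | nX | yes _ =
    ∈-spans⁺ˡ {i} {normalise i X} {Z} (nX m)
  attach-keeps i X@(⟨ A , B ⟩) Z k (inj₂ m) | nX | yes _ =
    ∈-spans⁺ʳ {i} {normalise i X} {Z}
      (subst (λ a → _ ∈ spans (i + a) Z) (sym (#leaves-normalise i X)) m)
  attach-keeps i X@(⟨ A , B ⟩) Z {z} k (inj₂ m) | _ | no _ =
    attach-keeps i A _ k (inj₂ (attach-keeps _ B Z k
      (inj₂ (subst (λ a → z ∈ spans a Z) (sym (+-assoc i (#leaves A) (#leaves B))) m))))
  attach-keeps i X@(⟨ A , B ⟩) Z k (inj₁ m) | _ | no ¬k with ∈-spans⁻ {i} {A} {B} m
  ... | inj₁ refl     = contradiction k ¬k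
  ... | inj₂ (inj₁ l) = attach-keeps i A _ k (inj₁ l)
  ... | inj₂ (inj₂ r) = attach-keeps i A _ k (inj₂ (attach-keeps _ B Z k (inj₁ r)))

  attach-root i ●             Z = here refl
  attach-root i X@(⟨ A , B ⟩) Z with K? (i , i + #leaves X)
  ... | yes _ = here (cong (λ a → i , i + (a + #leaves Z)) (sym (#leaves-normalise i X)))
  ... | no  _ = subst (λ a → (i , i + a) ∈ spans i (attach i A Z′))
    (trans (cong (#leaves A +_) (#leaves-attach _ B Z)) (sym (+-assoc (#leaves A) _ _)))
    (attach-root i A Z′)
    where Z′ = attach (i + #leaves A) B Z

  -- With left children restricted in this way, the split position of every node can be read off
  -- from the spans in `K`; this makes normal forms unique.
  data Normal (i : ℕ) : BinTree → Set where
    leafᴺ : Normal i ●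
    combᴺ : ∀ {B} → Normal (i + 1) B → Normal i ⟨ ● , B ⟩
    nodeᴺ : ∀ {A B} → K (i , i + #leaves A) →
           Normal i A → Normal (i + #leaves A) B → Normal i ⟨ A , B ⟩

  normalise-normal : ∀ i X → Normal i (normalise i X)
  attach-normal    : ∀ i X {Z} → Normal (i + #leaves X) Z → Normal i (attach i X Z)

  normalise-normal i ●         = leafᴺ
  normalise-normal i ⟨ A , B ⟩ = attach-normal i A (normalise-normal _ B)

  attach-normal i ●             nZ = combᴺ nZ
  attach-normal i X@(⟨ A , B ⟩) {Z} nZ with normalise-normal i X | K? (i , i + #leaves X)
  ... | nX | yes k =
    nodeᴺ (subst (λ a → K (i , i + a)) eq k) nX (subst (λ a → Normal (i + a) Z) eq nZ)
    where eq = sym (#leaves-normalise i X)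
  ... | _  | no _  = attach-normal i A (attach-normal _ B
    (subst (λ a → Normal a Z) (sym (+-assoc i (#leaves A) (#leaves B))) nZ))

  infix 4 _⊆ᴷ_
  _⊆ᴷ_ : List Span → List Span → Set
  xs ⊆ᴷ ys = ∀ {z} → K z → z ∈ xs → z ∈ ys

  module _ {i : ℕ} {A B A′ B′ : BinTree} where

    -- Among the spans of ⟨ A , B ⟩, those of A are the ones that end at most at
    -- the split position.
    ⊆ᴷ-left : #leaves A ≡ #leaves A′ →
              spans i ⟨ A , B ⟩ ⊆ᴷ spans i ⟨ A′ , B′ ⟩ → spans i A ⊆ᴷ spans i A′
    ⊆ᴷ-left eq sub k m with ∈-spans⁻ {i} {A′} {B′} (sub k (∈-spans⁺ˡ {i} {A} {B} m))
    ... | inj₂ (inj₁ l) = l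
    ... | inj₁ refl = contradiction (+-cancelˡ-≤ i _ _ (proj₂ (proj₂ (spans-range i A m))))
      (<⇒≱ (<-≤-trans (m<m+n (#leaves A) (0<#leaves B′))
             (≤-reflexive (cong (_+ #leaves B′) eq))))
    ... | inj₂ (inj₂ r) with spans-range i A m | spans-range (i + #leaves A′) B′ r
    ...   | _ , a<b , b≤ | ≤a , _ =
      contradiction (<-≤-trans a<b b≤)
        (≤⇒≯ (≤-trans (≤-reflexive (cong (i +_) eq)) ≤a))

    ⊆ᴷ-right : #leaves A ≡ #leaves A′ →
               spans i ⟨ A , B ⟩ ⊆ᴷ spans i ⟨ A′ , B′ ⟩ →
               spans (i + #leaves A) B ⊆ᴷ spans (i + #leaves A) B′
    ⊆ᴷ-right eq sub k m with ∈-spans⁻ {i} {A′} {B′} (sub k (∈-spans⁺ʳ {i} {A} {B} m))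
    ... | inj₂ (inj₂ r) rewrite eq = r
    ... | inj₁ refl = contradiction (proj₁ (spans-range (i + #leaves A) B m))
      (<⇒≱ (m<m+n i (0<#leaves A)))
    ... | inj₂ (inj₁ l) with spans-range (i + #leaves A) B m | spans-range i A′ l
    ...   | ≤a , _ | _ , a<b , b≤ =
      contradiction (<-≤-trans a<b b≤)
        (≤⇒≯ (≤-trans (≤-reflexive (cong (i +_) (sym eq))) ≤a))

    -- If `A` is not a leaf, its span is in `K` and so occurs in the other tree. There it is shorter
    -- than the root's span and starts at `i`, before any span of `B′`, so it lies within `A′`.
    left-≤ : Normal i ⟨ A , B ⟩ → #leaves ⟨ A , B ⟩ ≡ #leaves ⟨ A′ , B′ ⟩ →
             spans i ⟨ A , B ⟩ ⊆ᴷ spans i ⟨ A′ , B′ ⟩ → #leaves A ≤ #leaves A′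
    left-≤ (combᴺ _) eq sub = 0<#leaves A′
    left-≤ (nodeᴺ {A = ●} _ _ _) eq sub = 0<#leaves A′
    left-≤ (nodeᴺ {A = A@(⟨ _ , _ ⟩)} k _ _) eq sub
      with ∈-spans⁻ {i} {A′} {B′} (sub k (∈-spans⁺ˡ {i} {A} {B} (here refl)))
    ... | inj₁ p = contradiction (trans (+-cancelˡ-≡ i _ _ (cong proj₂ p)) (sym eq))
                     (<⇒≢ (m<m+n (#leaves A) (0<#leaves B)))
    ... | inj₂ (inj₁ l) = +-cancelˡ-≤ i _ _ (proj₂ (proj₂ (spans-range i A′ l)))
    ... | inj₂ (inj₂ r) = contradiction (proj₁ (spans-range (i + #leaves A′) B′ r))
                            (<⇒≱ (m<m+n i (0<#leaves A′)))

  normal-children : ∀ {i A B} → Normal i ⟨ A , B ⟩ →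
                    Normal i A × Normal (i + #leaves A) B
  normal-children (combᴺ nB)      = leafᴺ , nB
  normal-children (nodeᴺ _ nA nB) = nA , nB

  #leaves-node≢1 : ∀ L R → #leaves ⟨ L , R ⟩ ≢ 1
  #leaves-node≢1 L R eq = <⇒≢ (+-mono-≤ (0<#leaves L) (0<#leaves R)) (sym eq)

  -- `left-≤` in both directions makes the root split positions equal; the inclusions then restrict
  -- to the children.
  normal-unique : ∀ {i X Y} → Normal i X → Normal i Y → #leaves X ≡ #leaves Y →
                  spans i X ⊆ᴷ spans i Y → spans i Y ⊆ᴷ spans i X → X ≡ Y
  normal-unique {X = ●}         {●}           nX nY eq sub sup = refl
  normal-unique {X = ●}         {⟨ L , R ⟩}   nX nY eq sub sup =
    contradiction (sym eq) (#leaves-node≢1 L R)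
  normal-unique {X = ⟨ L , R ⟩} {●}           nX nY eq sub sup =
    contradiction eq (#leaves-node≢1 L R)
  normal-unique {i} {⟨ A , B ⟩} {⟨ A′ , B′ ⟩} nX nY eq sub sup
    with nA , nB ← normal-children nX | nA′ , nB′ ← normal-children nY =
    cong₂ ⟨_,_⟩
      (normal-unique nA nA′ eqA
        (⊆ᴷ-left {i} {A} {B} {A′} {B′} eqA sub)
        (⊆ᴷ-left {i} {A′} {B′} {A} {B} (sym eqA) sup))
      (normal-unique nB (subst (λ a → Normal (i + a) B′) (sym eqA) nB′) eqB
        (⊆ᴷ-right {i} {A} {B} {A′} {B′} eqA sub)
        (subst (λ a → spans (i + a) B′ ⊆ᴷ spans (i + a) B) (sym eqA)
          (⊆ᴷ-right {i} {A′} {B′} {A} {B} (sym eqA) sup)))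
    where
    eqA : #leaves A ≡ #leaves A′
    eqA = ≤-antisym (left-≤ {i} {A} {B} {A′} {B′} nX eq sub)
                    (left-≤ {i} {A′} {B′} {A} {B} nY (sym eq) sup)
    eqB : #leaves B ≡ #leaves B′
    eqB = +-cancelˡ-≡ (#leaves A) _ _ (trans eq (cong (_+ #leaves B′) (sym eqA)))

-- Upper bound by way of the common normal form

module _ (i : ℕ) (S T : BinTree) (eq : #nodes S ≡ #nodes T) where

  private
    lost kept : ℕ
    lost = #lost (_∈? spans i S) (spans i T)
    kept = #kept (_∈? spans i S) (spans i T)

    K : Pred Span 0ℓ
    K z = z ∈ spans i S × z ∈ spans i T

    K? : Decidable K
    K? z = (z ∈? spans i S) ×-dec (z ∈? spans i T)

    open Normalisation K?

    kept+lost : kept + lost ≡ #nodes T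
    kept+lost = trans (#kept+#lost (_∈? spans i S) (spans i T)) (length-spans i T)

    -- The trees have equally many spans and share the kept ones, so equally many remain on each
    -- side.
    #lost-sym : #lost (_∈? spans i T) (spans i S) ≡ lost
    #lost-sym = +-cancelˡ-≡ kept _ _ (begin
      kept + #lost (_∈? spans i T) (spans i S)
        ≡⟨ cong (_+ #lost (_∈? spans i T) (spans i S))
             (#kept-sym (spans-unique i S) (spans-unique i T)) ⟩
      #kept (_∈? spans i T) (spans i S) + #lost (_∈? spans i T) (spans i S)
        ≡⟨ #kept+#lost (_∈? spans i T) (spans i S) ⟩
      length (spans i S)
        ≡⟨ trans (length-spans i S) eq ⟩
      #nodes T
        ≡⟨ kept+lost ⟨
      kept + lost ∎)
      where open ≡-Reasoning

    -- As `K` consists of the common spans, `K z` alone puts `z` into both trees, hence by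
    -- `normalise-keeps` into both normal forms.
    same-normal-form : normalise i S ≡ normalise i T
    same-normal-form = normal-unique (normalise-normal i S) (normalise-normal i T)
      (begin
        #leaves (normalise i S) ≡⟨ #leaves-normalise i S ⟩
        #leaves S               ≡⟨ #leaves≡1+#nodes S ⟩
        suc (#nodes S)          ≡⟨ cong suc eq ⟩
        suc (#nodes T)          ≡⟨ #leaves≡1+#nodes T ⟨
        #leaves T               ≡⟨ #leaves-normalise i T ⟨
        #leaves (normalise i T) ∎)
      (λ k _ → normalise-keeps i T k (proj₂ k))
      (λ k _ → normalise-keeps i S k (proj₁ k))
      where open ≡-Reasoning

    path : S ⟷[≤ lost + lost ] T
    path = path-trans
      (path-weaken (≤-trans (#lost-mono (_∈? spans i T) K? (spans i S) _,_) (≤-reflexive #lost-sym))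
        (normalise-path i S))
      (subst (_⟷[≤ lost ] T) (sym same-normal-form)
        (path-sym (path-weaken (#lost-mono (_∈? spans i S) K? (spans i T) λ t s → s , t)
          (normalise-path i T))))

  -- The number of lost spans is written as `#nodes T ∸ kept` because the machine counts the kept
  -- ones. The path through the normal form shows that a distance exists and bounds it above; the
  -- shortest path gives the other inequality.
  rotationDistance-bounds :
    ∃[ d ] (IsRotationDistance S T d ×
            d ≤ 2 * (#nodes T ∸ kept) × 2 * (#nodes T ∸ kept) ≤ 2 * d)
  rotationDistance-bounds
    with d , isDistance@((ρ , refl) , minimal) ← rotationDistance (proj₁ path) =
    d , isDistance ,
    (begin
      d                      ≤⟨ minimal (proj₁ path) ⟩
      #rotations (proj₁ path) ≤⟨ proj₂ path ⟩
      lost + lost            ≡⟨ cong (lost +_) (+-identityʳ lost) ⟨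
      2 * lost               ≡⟨ cong (2 *_) lost≡ ⟩
      2 * (#nodes T ∸ kept)  ∎) ,
    *-monoʳ-≤ 2 (≤-trans (≤-reflexive (sym lost≡)) (#rotations-≥ i ρ))
    where
    open ≤-Reasoning
    lost≡ : lost ≡ #nodes T ∸ kept
    lost≡ = trans (sym (m+n∸m≡n kept lost)) (cong (_∸ kept) kept+lost)

-- Size of addresses and words

n≤2^⌈log₂n⌉ : ∀ n → n ≤ 2 ^ ⌈log₂ n ⌉
n≤2^⌈log₂n⌉ n = go n (<-wellFounded n)
  where
  open ≤-Reasoning
  -- Quantifying over the accessibility proof lets the induction follow the halving recursion of
  -- `⌈log2⌉`.
  go : ∀ n (rec : Acc _<_ n) → n ≤ 2 ^ ⌈log2⌉ n rec
  go 0 _ = z≤n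
  go 1 _ = ≤-refl
  go (suc (suc n)) (acc rs) = begin
    2 + n                         ≡⟨ cong (2 +_) (⌊n/2⌋+⌈n/2⌉≡n n) ⟨
    2 + (⌊ n /2⌋ + ⌈ n /2⌉)       ≤⟨ +-monoʳ-≤ 2 (+-monoˡ-≤ ⌈ n /2⌉ (⌊n/2⌋≤⌈n/2⌉ n)) ⟩
    2 + (⌈ n /2⌉ + ⌈ n /2⌉)       ≡⟨ double ⌈ n /2⌉ ⟩
    2 * suc ⌈ n /2⌉               ≤⟨ *-monoʳ-≤ 2 (go (suc ⌈ n /2⌉) _) ⟩
    2 * 2 ^ ⌈log2⌉ (suc ⌈ n /2⌉) _ ∎
    where
    double : ∀ m → 2 + (m + m) ≡ 2 * suc m
    double = solve-∀

module Layout (n : ℕ) where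

  -- `stride` exceeds the input addresses, at most `4 * n`, and the leaf numbers, at most `3 + n`.
  -- `limit` is `(3 + n) * stride + (3 + n)`, a bound for all table addresses and all computed
  -- values.
  stride limit : ℕ
  stride = 4 * suc n
  limit  = (3 + n) * suc stride

  -- With `N = 2 + n` the limit is below `8 * N ^ 2`, and `8 ≤ N ^ 3` because `2 ≤ N`. The resulting
  -- exponent 5 is the factor `3 + k` of the word size for `k = 2`.
  limit-fits : limit < 2 ^ wordSize 2 n
  limit-fits = begin-strict
    (3 + n) * suc stride   ≤⟨ *-monoˡ-≤ (suc stride) 3+n≤2*N ⟩
    2 * N * suc stride     <⟨ *-monoʳ-< (2 * N) 1+stride<4*N ⟩
    2 * N * (4 * N)        ≡⟨ regroup N ⟩
    2 ^ 3 * N ^ 2          ≤⟨ *-monoˡ-≤ (N ^ 2) (^-monoˡ-≤ 3 (m≤m+n 2 n)) ⟩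
    N ^ 3 * N ^ 2          ≡⟨ ^-distribˡ-+-* N 3 2 ⟨
    N ^ 5                  ≤⟨ ^-monoˡ-≤ 5 (n≤2^⌈log₂n⌉ N) ⟩
    (2 ^ ⌈log₂ N ⌉) ^ 5    ≡⟨ ^-*-assoc 2 ⌈log₂ N ⌉ 5 ⟩
    2 ^ (⌈log₂ N ⌉ * 5)    ≡⟨ cong (2 ^_) (*-comm ⌈log₂ N ⌉ 5) ⟩
    2 ^ (5 * ⌈log₂ N ⌉)    ∎
    where
    open ≤-Reasoning
    N = 2 + n
    3+n≤2*N : 3 + n ≤ 2 * N
    3+n≤2*N = ≤-trans (m≤m+n (3 + n) (1 + n)) (≤-reflexive (lemma n))
      where
      lemma : ∀ n → 3 + n + (1 + n) ≡ 2 * (2 + n)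
      lemma = solve-∀
    1+stride<4*N : suc stride < 4 * N
    1+stride<4*N = ≤-trans (m≤m+n (2 + stride) 2) (≤-reflexive (lemma n))
      where
      lemma : ∀ n → suc (suc (4 * suc n)) + 2 ≡ 4 * (2 + n)
      lemma = solve-∀
    regroup : ∀ m → 2 * m * (4 * m) ≡ 8 * (m * (m * 1))
    regroup = solve-∀

-- Composable runs of the machine

module Machine (w : ℕ) (P : Program) where

  infix 4 _↝[_]_
  infixr 5 _»_

  -- Quantifying over the remaining time `t` lets runs compose by adding their lengths and yields
  -- the value of `exec` directly.
  record _↝[_]_ (s : State) (k : ℕ) (s′ : State) : Set where
    constructor run
    field exec-run : ∀ t → exec w P (k + t) s ≡ exec w P t s′
  open _↝[_]_ public

  _»_ : ∀ {j k s s′ s″} → s ↝[ j ] s′ → s′ ↝[ k ] s″ → s ↝[ j + k ] s″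
  _»_ {j} {k} {s} (run p) (run q) =
    run λ t → trans (cong (λ u → exec w P u s) (+-assoc j k t)) (trans (p (k + t)) (q t))

  word-fits : ∀ {x} → x < 2 ^ w → word w x ≡ just x
  word-fits {x} x< = cong (λ b → if b then just x else nothing) (Equivalence.to T-≡ (<⇒<ᵇ x<))

  step-run : ∀ {s s′ ι} → fetch P (State.pc s) ≡ just ι → step w ι s ≡ just s′ → s ↝[ 1 ] s′
  step-run {s} {s′} {ι} f e = run λ t → trans (cong (_>>= dispatch w P t s) f) (dispatch-step ι t e)
    where
    -- `dispatch` reduces only on a known instruction. The case `halt` is absurd, as its `step` is
    -- `nothing`.
    dispatch-step : ∀ ι t → step w ι s ≡ just s′ → dispatch w P t s ι ≡ exec w P t s′
    dispatch-step (set _ _)       t e = cong (_>>= exec w P t) e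
    dispatch-step (arith _ _ _ _) t e = cong (_>>= exec w P t) e
    dispatch-step (load _ _)      t e = cong (_>>= exec w P t) e
    dispatch-step (store _ _)     t e = cong (_>>= exec w P t) e
    dispatch-step (jump _)        t e = cong (_>>= exec w P t) e
    dispatch-step (jzero _ _)     t e = cong (_>>= exec w P t) e

  module _ {i : ℕ} {ρ : Register → ℕ} {M : Memory} where

    run-set : ∀ {r x} → fetch P i ≡ just (set r x) → x < 2 ^ w →
              state i ρ M ↝[ 1 ] state (suc i) (ρ [ r ↦ x ]) M
    run-set f x< = step-run f (cong (Maybe.map _) (word-fits x<))

    run-arith : ∀ {o r s t v} → fetch P i ≡ just (arith o r s t) →
                apply o (ρ s) (ρ t) ≡ v → v < 2 ^ w →
                state i ρ M ↝[ 1 ] state (suc i) (ρ [ r ↦ v ]) M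
    run-arith f refl v< = step-run f (cong (Maybe.map _) (word-fits v<))

    run-load : ∀ {r s a v} → fetch P i ≡ just (load r s) → ρ s ≡ a → M a ≡ v →
               state i ρ M ↝[ 1 ] state (suc i) (ρ [ r ↦ v ]) M
    run-load f refl refl = step-run f refl

    run-store : ∀ {r s a v} → fetch P i ≡ just (store r s) → ρ r ≡ a → ρ s ≡ v →
                state i ρ M ↝[ 1 ] state (suc i) ρ (M [ a ↦ v ])
    run-store f refl refl = step-run f refl

    run-jump : ∀ {ℓ} → fetch P i ≡ just (jump ℓ) → state i ρ M ↝[ 1 ] state ℓ ρ M
    run-jump f = step-run f refl

    run-jzero : ∀ {r ℓ} → fetch P i ≡ just (jzero r ℓ) → ρ r ≡ 0 →
                state i ρ M ↝[ 1 ] state ℓ ρ M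
    run-jzero {ℓ = ℓ} f z =
      step-run f (cong (λ x → just (state (branch x ℓ (suc i)) ρ M)) z)

    run-jnonzero : ∀ {r ℓ} → fetch P i ≡ just (jzero r ℓ) → 0 < ρ r →
                   state i ρ M ↝[ 1 ] state (suc i) ρ M
    run-jnonzero {r} {ℓ} f nz = step-run f (cong (λ j → just (state j ρ M)) (branch-suc nz))
      where
      branch-suc : ∀ {x} → 0 < x → branch x ℓ (suc i) ≡ suc i
      branch-suc (s≤s _) = refl

-- The program and its correctness

-- r0 current pointer, r1 root of the tree still to be traversed (0 if none),
-- r2 = n, r3 stack pointer, r4 number of the next leaf, r5 count, r6 = stride,
-- r7 = 1, r8 = 0; r9, r10 and r11 are scratch.  A node p whose first leaf is c
-- has the stack frame (p , c) while its left subtree is visited and (0 , c)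
-- while its right one is.  The stack lies between stride and 2 * stride, the
-- cell of the span (a , b) at a * stride + b; leaves are numbered from 2 so
-- that the table lies above the stack.  Leaf numbers are positive, whence the
-- blank cell at address stride marks the bottom of the stack.
program : Program
program =
    set 7 1
  ∷ set 6 4
  ∷ arith times 6 2 6
  ∷ set 9 4
  ∷ arith plus 6 6 9
  ∷ arith plus 3 6 7
  -- 6: next tree
  ∷ set 4 2
  -- 7: visit
  ∷ jzero 0 14
  ∷ store 3 0
  ∷ arith plus 9 3 7
  ∷ store 9 4
  ∷ arith plus 3 9 7
  ∷ load 0 0
  ∷ jump 7
  -- 14: leaf
  ∷ arith plus 4 4 7
  -- 15: return to the node on top of the stack
  ∷ arith minus 9 3 7
  ∷ load 10 9
  ∷ jzero 10 34
  ∷ arith minus 9 9 7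
  ∷ load 11 9
  ∷ jzero 11 25
  ∷ store 9 8
  ∷ arith plus 11 11 7
  ∷ load 0 11
  ∷ jump 7
  -- 25: both children are done
  ∷ arith plus 3 9 8
  ∷ arith times 10 10 6
  ∷ arith plus 10 10 4
  ∷ jzero 1 31
  ∷ store 10 7
  ∷ jump 33
  -- 31: count
  ∷ load 11 10
  ∷ arith plus 5 5 11
  ∷ jump 15
  -- 34: stack empty
  ∷ jzero 1 38
  ∷ arith plus 0 1 8
  ∷ set 1 0
  ∷ jump 6
  -- 38: output
  ∷ arith minus 0 2 5
  ∷ arith plus 0 0 0
  ∷ halt
  ∷ []

-- The traversals as pure functions

occurs : Span → List Span → ℕ
occurs z xs = if does (z ∈? xs) then 1 else 0

occurs≤1 : ∀ z xs → occurs z xs ≤ 1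
occurs≤1 z xs with does (z ∈? xs)
... | true  = ≤-refl
... | false = z≤n

occurs-here : ∀ z xs → occurs z (z ∷ xs) ≡ 1
occurs-here z xs =
  cong (λ b → if b ∨ does (z ∈? xs) then 1 else 0) (dec-true (z ≟ˢ z) refl)

occurs-there : ∀ {y z} xs → y ≢ z → occurs y (z ∷ xs) ≡ occurs y xs
occurs-there {y} {z} xs y≢z =
  cong (λ b → if b ∨ does (y ∈? xs) then 1 else 0) (dec-false (y ≟ˢ z) y≢z)

-- The contents q of register 1 tell the two traversals apart: while it is
-- the (nonzero) root of the second tree, spans are recorded; once it has
-- been cleared, recorded spans are counted.
act : ℕ → Span → ℕ × List Span → ℕ × List Span
act zero    z (k , xs) = k + occurs z xs , xs
act (suc _) z (k , xs) = k , z ∷ xs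

traverse : ℕ → ℕ → BinTree → ℕ × List Span → ℕ × List Span
traverse q i ●         d = d
traverse q i ⟨ L , R ⟩ d =
  act q (i , i + #leaves ⟨ L , R ⟩) (traverse q (i + #leaves L) R (traverse q i L d))

-- Spans are consed in postorder and so come out root first, then right subtree, then left: the
-- order in which `spans` lists them.
traverse-record : ∀ q i T k xs → traverse (suc q) i T (k , xs) ≡ (k , spans i T ++ xs)
traverse-record q i ●         k xs = refl
traverse-record q i ⟨ L , R ⟩ k xs
  rewrite traverse-record q i L k xs
        | traverse-record q (i + #leaves L) R k (spans i L ++ xs)
        | ++-assoc (spans (i + #leaves L) R) (spans i L) xs = refl

#kept-∷ : ∀ xs z ys → #kept (_∈? xs) (z ∷ ys) ≡ #kept (_∈? xs) ys + occurs z xs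
#kept-∷ xs z ys with z ∈? xs
... | yes _ = sym (+-comm _ 1)
... | no  _ = sym (+-identityʳ _)

traverse-count : ∀ i T k xs →
                 traverse 0 i T (k , xs) ≡ (k + #kept (_∈? xs) (spans i T) , xs)
traverse-count i ●         k xs = cong (_, xs) (sym (+-identityʳ k))
traverse-count i ⟨ L , R ⟩ k xs
  rewrite traverse-count i L k xs
        | traverse-count (i + #leaves L) R (k + #kept (_∈? xs) (spans i L)) xs = cong (_, xs) (begin
  k + #kept (_∈? xs) sL + #kept (_∈? xs) sR + occurs z xs
    ≡⟨ regroup k (#kept (_∈? xs) sL) (#kept (_∈? xs) sR) (occurs z xs) ⟩
  k + (#kept (_∈? xs) sR + #kept (_∈? xs) sL + occurs z xs)
    ≡⟨ cong (λ m → k + (m + occurs z xs)) #kept-++ ⟨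
  k + (#kept (_∈? xs) (sR ++ sL) + occurs z xs)
    ≡⟨ cong (k +_) (#kept-∷ xs z (sR ++ sL)) ⟨
  k + #kept (_∈? xs) (z ∷ sR ++ sL) ∎)
  where
  open ≡-Reasoning
  sL = spans i L
  sR = spans (i + #leaves L) R
  z = (i , i + #leaves ⟨ L , R ⟩)
  #kept-++ : #kept (_∈? xs) (sR ++ sL) ≡ #kept (_∈? xs) sR + #kept (_∈? xs) sL
  #kept-++ = trans (cong length (filter-++ (_∈? xs) sR sL)) (length-++ (filter (_∈? xs) sR))
  regroup : ∀ a b c d → a + b + c + d ≡ a + (c + b + d)
  regroup = solve-∀

act-≤ : ∀ q z d → proj₁ (act q z d) ≤ suc (proj₁ d)
act-≤ zero    z (k , xs) = ≤-trans (+-monoʳ-≤ k (occurs≤1 z xs)) (≤-reflexive (+-comm k 1))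
act-≤ (suc _) z (k , xs) = n≤1+n k

-- This keeps the counter small enough for a word throughout the traversal.
traverse-≤ : ∀ q i T d → proj₁ (traverse q i T d) ≤ proj₁ d + #nodes T
traverse-≤ q i ●         d = m≤m+n _ 0
traverse-≤ q i ⟨ L , R ⟩ d = begin
  proj₁ (traverse q i ⟨ L , R ⟩ d)
    ≤⟨ act-≤ q (i , i + #leaves ⟨ L , R ⟩) dR ⟩
  suc (proj₁ dR)
    ≤⟨ s≤s (traverse-≤ q (i + #leaves L) R dL) ⟩
  suc (proj₁ dL + #nodes R)
    ≤⟨ s≤s (+-monoˡ-≤ (#nodes R) (traverse-≤ q i L d)) ⟩
  suc (proj₁ d + #nodes L + #nodes R)
    ≡⟨ regroup (proj₁ d) (#nodes L) (#nodes R) ⟩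
  proj₁ d + #nodes ⟨ L , R ⟩ ∎
  where
  open ≤-Reasoning
  dL = traverse q i L d
  dR = traverse q (i + #leaves L) R dL
  regroup : ∀ a b c → suc (a + b + c) ≡ a + (b + suc c)
  regroup = solve-∀

-- Memory updates, table addresses and running time

update-same : ∀ f i x → (f [ i ↦ x ]) i ≡ x
update-same f i x = cong (λ b → if b then x else f i) (Equivalence.to T-≡ (≡⇒≡ᵇ i i refl))

update-other : ∀ f {i j} x → j ≢ i → (f [ i ↦ x ]) j ≡ f j
update-other f {i} {j} x j≢i with j ≡ᵇ i in eq
... | true  = contradiction (≡ᵇ⇒≡ j i (Equivalence.from T-≡ eq)) j≢i
... | false = refl

*+-injective : ∀ m .{{_ : NonZero m}} {a a′ b b′} → b < m → b′ < m →
               a * m + b ≡ a′ * m + b′ → a ≡ a′ × b ≡ b′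
*+-injective m {a} {a′} {b} {b′} b<m b′<m eq = *-cancelʳ-≡ a a′ m a≡ , b≡
  where
  rem : ∀ a {b} → b < m → (a * m + b) % m ≡ b
  rem a {b} b<m = trans (cong (_% m) (+-comm (a * m) b))
    (trans ([m+kn]%n≡m%n b a m) (m<n⇒m%n≡m b<m))
  b≡ : b ≡ b′
  b≡ = trans (sym (rem a b<m)) (trans (cong (_% m) eq) (rem a′ b′<m))
  a≡ : a * m ≡ a′ * m
  a≡ = +-cancelʳ-≡ b (a * m) (a′ * m) (trans eq (cong (a′ * m +_) (sym b≡)))

-- The summands 7, 10 and 13 are the lengths of `descend`, `resume` and `finish`, nested like the
-- composed runs in `visit`.
time : BinTree → ℕ
time ●         = 2
time ⟨ L , R ⟩ = 7 + (time L + (10 + (time R + 13)))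

time≡ : ∀ T → time T ≡ 32 * #nodes T + 2
time≡ ●         = refl
time≡ ⟨ L , R ⟩ rewrite time≡ L | time≡ R = lemma (#nodes L) (#nodes R)
  where
  lemma : ∀ a b → 7 + (32 * a + 2 + (10 + (32 * b + 2 + 13))) ≡ 32 * (a + suc b) + 2
  lemma = solve-∀

-- Simulation of the traversals by the machine

module Correctness (n w : ℕ) (limit< : Layout.limit n < 2 ^ w) (M₀ : Memory) where

  open Layout n
  open Machine w program

  key : ℕ → ℕ → ℕ
  key a b = a * stride + b

  fits : ∀ {x} → x ≤ limit → x < 2 ^ w
  fits x≤ = ≤-<-trans x≤ limit<

  2*stride≤limit : 2 * stride ≤ limit
  2*stride≤limit = *-mono-≤ {2} {3 + n} (s≤s (s≤s z≤n)) (n≤1+n stride)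

  stride≤limit : stride ≤ limit
  stride≤limit = ≤-trans (m≤m+n stride _) 2*stride≤limit

  3+n<stride : 3 + n < stride
  3+n<stride = s≤s (≤-trans (m≤m+n (3 + n) (3 * n)) (≤-reflexive (lemma n)))
    where
    lemma : ∀ n → 3 + n + 3 * n ≡ n + 3 * suc n
    lemma = solve-∀

  4*n<stride : 4 * n < stride
  4*n<stride = *-monoʳ-< 4 (n<1+n n)

  3+n≤limit : 3 + n ≤ limit
  3+n≤limit = ≤-trans (<⇒≤ 3+n<stride) stride≤limit

  4*n≤limit : 4 * n ≤ limit
  4*n≤limit = ≤-trans (<⇒≤ 4*n<stride) stride≤limit

  key≤limit : ∀ {a b} → a ≤ 3 + n → b ≤ 3 + n → key a b ≤ limit
  key≤limit {a} {b} a≤ b≤ = ≤-trans (+-mono-≤ (*-monoˡ-≤ stride a≤) b≤)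
    (≤-reflexive (trans (+-comm _ (3 + n)) (sym (*-suc (3 + n) stride))))

  2*stride≤key : ∀ {a} b → 2 ≤ a → 2 * stride ≤ key a b
  2*stride≤key b 2≤a = ≤-trans (*-monoˡ-≤ stride 2≤a) (m≤m+n _ b)

  Regs : (q sp c k : ℕ) → (Register → ℕ) → Set
  Regs q sp c k ρ = ρ 1 ≡ q × ρ 2 ≡ n × ρ 3 ≡ sp × ρ 4 ≡ c × ρ 5 ≡ k ×
                    ρ 6 ≡ stride × ρ 7 ≡ 1 × ρ 8 ≡ 0

  -- The table is described only for `2 ≤ a` and `b < stride`, where its cells lie above the stack
  -- and `key` is injective. Stack cells are left to `Agree`.
  record Mem (xs : List Span) (M : Memory) : Set where
    field
      input : ∀ {a} → a ≤ 4 * n → M a ≡ M₀ a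
      table : ∀ {a b} → 2 ≤ a → b < stride → M (key a b) ≡ occurs (a , b) xs
  open Mem

  -- Frame condition: whatever happens above `sp`, the pending stack frames below it survive.
  Agree : ℕ → Memory → Memory → Set
  Agree sp M M′ = ∀ {a} → a < sp → M′ a ≡ M a

  update-agree : ∀ {sp M a v} → sp ≤ a → Agree sp M (M [ a ↦ v ])
  update-agree {M = M} sp≤a b<sp = update-other M _ (<⇒≢ (<-≤-trans b<sp sp≤a))

  update-stack : ∀ {xs M a v} → Mem xs M → stride < a → a < 2 * stride → Mem xs (M [ a ↦ v ])
  update-stack {M = M} m <a a< .input b≤ =
    trans (update-other M _ (<⇒≢ (≤-<-trans b≤ (<-trans 4*n<stride <a)))) (m .input b≤)
  update-stack {M = M} m <a a< .table {b = b} 2≤ b< =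
    trans (update-other M _ (>⇒≢ (<-≤-trans a< (2*stride≤key b 2≤)))) (m .table 2≤ b<)

  update-table : ∀ {xs M a b} → Mem xs M → 2 ≤ a → b < stride →
                 Mem ((a , b) ∷ xs) (M [ key a b ↦ 1 ])
  update-table {M = M} {a} {b} m 2≤a b< .input c≤ =
    trans (update-other M 1 (<⇒≢ (≤-<-trans c≤ (<-≤-trans 4*n<stride
      (≤-trans (m≤m+n stride _) (2*stride≤key b 2≤a)))))) (m .input c≤)
  update-table {xs} {M} {a} {b} m 2≤a b< .table {a′} {b′} 2≤a′ b′< =
    cases ((a′ , b′) ≟ˢ (a , b))
    where
    key-injective : key a′ b′ ≡ key a b → (a′ , b′) ≡ (a , b)
    key-injective eq with refl , refl ← *+-injective stride {a′} {a} b′< b< eq = refl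
    cases : Dec ((a′ , b′) ≡ (a , b)) →
            (M [ key a b ↦ 1 ]) (key a′ b′) ≡ occurs (a′ , b′) ((a , b) ∷ xs)
    cases (yes refl) = trans (update-same M (key a b) 1) (sym (occurs-here (a , b) xs))
    cases (no ≢)     = trans (update-other M 1 (≢ ∘ key-injective))
                         (trans (m .table 2≤a′ b′<) (sym (occurs-there xs ≢)))

  descend : ∀ {q sp c k p xs} ρ {M} → Regs q sp c k ρ → Mem xs M →
            ρ 0 ≡ p → 0 < p → p ≤ 4 * n →
            stride < sp → 2 + sp ≤ 2 * stride → c ≤ 3 + n →
            let M′ = (M [ sp ↦ p ]) [ suc sp ↦ c ] in
            ∃[ ρ′ ] (state 7 ρ M ↝[ 7 ] state 7 ρ′ M′ ×
                     Regs q (2 + sp) c k ρ′ × ρ′ 0 ≡ M₀ p)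
  descend {sp = sp} ρ (r1 , r2 , r3 , r4 , r5 , r6 , r7 , r8) m r0 0<p p≤ <sp sp≤ c≤ =
    _ ,
    ( run-jnonzero refl (subst (0 <_) (sym r0) 0<p)
    » run-store refl r3 r0
    » run-arith refl (trans (cong₂ _+_ r3 r7) (+-comm sp 1)) (fits (≤-trans (n≤1+n _) 2+sp≤limit))
    » run-store refl refl r4
    » run-arith refl (trans (cong (suc sp +_) r7) (+-comm (suc sp) 1)) (fits 2+sp≤limit)
    » run-load refl r0 (m″ .input p≤)
    » run-jump refl ) ,
    (r1 , r2 , refl , r4 , r5 , r6 , r7 , r8) , refl
    where
    2+sp≤limit = ≤-trans sp≤ 2*stride≤limit
    m″ = update-stack (update-stack m <sp (<-trans (n<1+n _) sp≤)) (m<n⇒m<1+n <sp) sp≤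

  resume : ∀ {q sp c c′ k p xs} ρ {M} → Regs q (2 + sp) c′ k ρ → Mem xs M →
           M sp ≡ p → M (suc sp) ≡ c → 0 < p → suc p ≤ 4 * n →
           stride < sp → 2 + sp ≤ 2 * stride → 2 ≤ c →
           ∃[ ρ′ ] (state 15 ρ M ↝[ 10 ] state 7 ρ′ (M [ sp ↦ 0 ]) ×
                    Regs q (2 + sp) c′ k ρ′ × ρ′ 0 ≡ M₀ (suc p))
  resume {sp = sp} {p = p} ρ (r1 , r2 , r3 , r4 , r5 , r6 , r7 , r8) m Msp Mssp 0<p p< <sp sp≤ 2≤c =
    _ ,
    ( run-arith refl (cong₂ _∸_ r3 r7) (fits (≤-trans (n≤1+n _) 2+sp≤limit))
    » run-load refl refl Mssp
    » run-jnonzero refl (<-trans (s≤s z≤n) 2≤c)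
    » run-arith refl (cong (suc sp ∸_) r7) (fits (≤-trans (m≤n+m _ 2) 2+sp≤limit))
    » run-load refl refl Msp
    » run-jnonzero refl 0<p
    » run-store refl refl r8
    » run-arith refl (trans (cong (p +_) r7) (+-comm p 1))
        (fits (≤-trans p< 4*n≤limit))
    » run-load refl refl (update-stack m <sp (<-trans (n<1+n _) sp≤) .input p<)
    » run-jump refl ) ,
    (r1 , r2 , r3 , r4 , r5 , r6 , r7 , r8) , refl
    where
    2+sp≤limit = ≤-trans sp≤ 2*stride≤limit

  -- After the nine steps of `to-branch`, counting and recording both take four; the recording
  -- branch reaches 15 through two jumps. Hence the cost is the same for every `q`.
  finish : ∀ q {sp c e d} ρ {M} → Regs q (2 + sp) e (proj₁ d) ρ → Mem (proj₂ d) M →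
           M sp ≡ 0 → M (suc sp) ≡ c →
           stride < sp → 2 + sp ≤ 2 * stride → 2 ≤ c → c ≤ 3 + n → e ≤ 3 + n →
           proj₁ (act q (c , e) d) ≤ n →
           ∃₂ λ ρ′ M′ → state 15 ρ M ↝[ 13 ] state 15 ρ′ M′ ×
                        Regs q sp e (proj₁ (act q (c , e) d)) ρ′ ×
                        Mem (proj₂ (act q (c , e) d)) M′ × Agree sp M M′
  finish q {sp} {c} {e} {k , xs} ρ {M} (r1 , r2 , r3 , r4 , r5 , r6 , r7 , r8) m
         Msp Mssp <sp sp≤ 2≤c c≤ e≤ k≤ = branches q r1 k≤
    where
    2+sp≤limit = ≤-trans sp≤ 2*stride≤limit
    sp≤limit   = ≤-trans (m≤n+m _ 2) 2+sp≤limit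
    c*s≤limit : c * stride ≤ limit
    c*s≤limit = ≤-trans (m≤m+n _ e) (key≤limit c≤ e≤)
    ρ₁ : Register → ℕ
    ρ₁ = (((((((ρ [ 9 ↦ suc sp ]) [ 10 ↦ c ]) [ 9 ↦ sp ]) [ 11 ↦ 0 ]) [ 3 ↦ sp ])
           [ 10 ↦ c * stride ]) [ 10 ↦ key c e ])
    to-branch : state 15 ρ M ↝[ 9 ] state 28 ρ₁ M
    to-branch =
        run-arith refl (cong₂ _∸_ r3 r7) (fits (≤-trans (n≤1+n _) 2+sp≤limit))
      » run-load refl refl Mssp
      » run-jnonzero refl (<-trans (s≤s z≤n) 2≤c)
      » run-arith refl (cong (suc sp ∸_) r7) (fits sp≤limit)
      » run-load refl refl Msp
      » run-jzero refl refl
      » run-arith refl (trans (cong (sp +_) r8) (+-identityʳ sp)) (fits sp≤limit)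
      » run-arith refl (cong (c *_) r6) (fits c*s≤limit)
      » run-arith refl (cong (c * stride +_) r4) (fits (key≤limit c≤ e≤))
    e< : e < stride
    e< = ≤-<-trans e≤ 3+n<stride
    branches : ∀ q → ρ 1 ≡ q → proj₁ (act q (c , e) (k , xs)) ≤ n →
      ∃₂ λ ρ′ M′ → state 15 ρ M ↝[ 13 ] state 15 ρ′ M′ ×
                   Regs q sp e (proj₁ (act q (c , e) (k , xs))) ρ′ ×
                   Mem (proj₂ (act q (c , e) (k , xs))) M′ × Agree sp M M′
    branches zero r1 k≤ =
      _ , _ ,
      ( to-branch
      » run-jzero refl r1
      » run-load refl refl (m .table 2≤c e<)
      » run-arith refl (cong (_+ occurs (c , e) xs) r5)
          (fits (≤-trans k≤ (m+n≤o⇒n≤o 3 3+n≤limit)))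
      » run-jump refl ) ,
      (r1 , r2 , refl , r4 , refl , r6 , r7 , r8) , m , λ _ → refl
    branches (suc q) r1 _ =
      _ , _ ,
      ( to-branch
      » run-jnonzero refl (subst (0 <_) (sym r1) (s≤s z≤n))
      » run-store refl refl r7
      » run-jump refl
      » run-jump refl ) ,
      (r1 , r2 , refl , r4 , r5 , r6 , r7 , r8) , update-table m 2≤c e< ,
      update-agree {M = M} (≤-trans (<⇒≤ (<-trans (n<1+n _) sp≤)) (2*stride≤key e 2≤c))

  -- The three numerical hypotheses are budgets: each node still to be visited may take two stack
  -- cells, one leaf number and one increment of the counter. Thus they pass on to both subtrees.
  visit : ∀ {T p as} → Stores M₀ T p as → All (_≤ 4 * n) as →
          ∀ q {sp c} d ρ {M} → ρ 0 ≡ p → Regs q sp c (proj₁ d) ρ → Mem (proj₂ d) M →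
          stride < sp → sp + 2 * #nodes T ≤ 2 * stride →
          2 ≤ c → c + #nodes T ≤ 2 + n → proj₁ d + #nodes T ≤ n →
          ∃₂ λ ρ′ M′ → state 7 ρ M ↝[ time T ] state 15 ρ′ M′ ×
                       Regs q sp (c + #leaves T) (proj₁ (traverse q c T d)) ρ′ ×
                       Mem (proj₂ (traverse q c T d)) M′ × Agree sp M M′
  visit leaf _ q {c = c} d ρ r0 (r1 , r2 , r3 , r4 , r5 , r6 , r7 , r8) m <sp sp≤ 2≤c c≤ k≤ =
    _ , _ ,
    ( run-jzero refl r0
    » run-arith refl (cong₂ _+_ r4 r7) (fits (≤-trans c+1≤3+n 3+n≤limit)) ) ,
    (r1 , r2 , r3 , refl , r5 , r6 , r7 , r8) , m , λ _ → refl
    where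
    c+1≤3+n : c + 1 ≤ 3 + n
    c+1≤3+n = ≤-trans (≤-reflexive (+-comm c 1)) (s≤s (m+n≤o⇒m≤o c c≤))
  visit {T = ⟨ L , R ⟩} {p} (node {as = as} 0<p sL sR) (p≤ ∷ p+1≤ ∷ as≤) q {sp} {c} d ρ {M}
        r0 regs m <sp sp≤ 2≤c c≤ k≤ =
    case descend ρ regs m r0 0<p p≤ <sp 2+sp≤ c≤3+n of λ where
      (ρ₁ , run₁ , regs₁ , r0₁) →
        case visit sL (proj₁ (All.++⁻ as as≤)) q d ρ₁ r0₁ regs₁
               (update-stack (update-stack m <sp sp<) (m<n⇒m<1+n <sp) 2+sp≤)
               <2+sp spL≤ 2≤c cL≤ kL≤ of λ where
          (ρ₂ , M₂ , run₂ , regs₂ , m₂ , agree₂) →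
            -- The node's own frame occupies `sp` and `suc sp`, just below the stack pointer of the
            -- subtree visits, so they preserve it.
            case resume ρ₂ regs₂ m₂ (trans (agree₂ (n≤1+n _)) M₁-sp) (trans (agree₂ ≤-refl) M₁-1+sp)
                   0<p p+1≤ <sp 2+sp≤ 2≤c of λ where
              (ρ₃ , run₃ , regs₃ , r0₃) →
                case visit sR (proj₂ (All.++⁻ as as≤)) q (traverse q c L d) ρ₃ r0₃ regs₃
                       (update-stack m₂ <sp sp<)
                       <2+sp spR≤ (m≤n⇒m≤n+o _ 2≤c) cR≤ kR≤ of λ where
                  (ρ₄ , M₄ , run₄ , regs₄ , m₄ , agree₄) →
                    case finish q ρ₄
                           (subst (λ e → Regs q (2 + sp) e (proj₁ dR) ρ₄)
                             (+-assoc c (#leaves L) (#leaves R)) regs₄)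
                           m₄
                           (trans (agree₄ (n≤1+n _)) (update-same M₂ sp 0))
                           (trans (agree₄ ≤-refl)
                             (trans (update-other M₂ 0 (>⇒≢ (n<1+n sp)))
                               (trans (agree₂ ≤-refl) M₁-1+sp)))
                           <sp 2+sp≤ 2≤c c≤3+n e≤3+n
                           (≤-trans (traverse-≤ q c ⟨ L , R ⟩ d) k≤) of λ where
                      (ρ₅ , M₅ , run₅ , regs₅ , m₅ , agree₅) →
                        ρ₅ , M₅ , (run₁ » run₂ » run₃ » run₄ » run₅) , regs₅ , m₅ ,
                        λ {a} a< → trans (agree₅ a<)
                          (trans (agree₄ (m<n⇒m<1+n (m<n⇒m<1+n a<)))
                          (trans (update-agree {M = M₂} ≤-refl a<)
                          (trans (agree₂ (m<n⇒m<1+n (m<n⇒m<1+n a<)))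
                          (trans (update-agree {M = M [ sp ↦ p ]} (n≤1+n sp) a<)
                                 (update-agree {M = M} ≤-refl a<)))))
    where
    M₁ = (M [ sp ↦ p ]) [ suc sp ↦ c ]
    M₁-sp : M₁ sp ≡ p
    M₁-sp = trans (update-other (M [ sp ↦ p ]) c (<⇒≢ (n<1+n sp))) (update-same M sp p)
    M₁-1+sp : M₁ (suc sp) ≡ c
    M₁-1+sp = update-same (M [ sp ↦ p ]) (suc sp) c
    l = #nodes L
    r = #nodes R
    dR = traverse q (c + #leaves L) R (traverse q c L d)
    spL≤ : 2 + sp + 2 * l ≤ 2 * stride
    spL≤ = ≤-trans (m≤m+n _ (2 * r)) (≤-trans (≤-reflexive (lemma sp l r)) sp≤)
      where
      lemma : ∀ s a b → 2 + s + 2 * a + 2 * b ≡ s + 2 * (a + suc b)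
      lemma = solve-∀
    spR≤ : 2 + sp + 2 * r ≤ 2 * stride
    spR≤ = ≤-trans (m≤m+n _ (2 * l)) (≤-trans (≤-reflexive (lemma sp l r)) sp≤)
      where
      lemma : ∀ s a b → 2 + s + 2 * b + 2 * a ≡ s + 2 * (a + suc b)
      lemma = solve-∀
    2+sp≤ : 2 + sp ≤ 2 * stride
    2+sp≤ = m+n≤o⇒m≤o (2 + sp) spL≤
    sp< : sp < 2 * stride
    sp< = <-trans (n<1+n sp) 2+sp≤
    <2+sp : stride < 2 + sp
    <2+sp = m<n⇒m<1+n (m<n⇒m<1+n <sp)
    cL≤ : c + l ≤ 2 + n
    cL≤ = ≤-trans (+-monoʳ-≤ c (m≤m+n l _)) c≤
    cR≤ : c + #leaves L + r ≤ 2 + n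
    cR≤ rewrite #leaves≡1+#nodes L = ≤-trans (≤-reflexive (lemma c l r)) c≤
      where
      lemma : ∀ c a b → c + suc a + b ≡ c + (a + suc b)
      lemma = solve-∀
    c≤3+n : c ≤ 3 + n
    c≤3+n = m≤n⇒m≤1+n (m+n≤o⇒m≤o c c≤)
    e≤3+n : c + (#leaves L + #leaves R) ≤ 3 + n
    e≤3+n rewrite #leaves≡1+#nodes L | #leaves≡1+#nodes R =
      ≤-trans (≤-reflexive (+-suc c _)) (s≤s c≤)
    kL≤ : proj₁ d + l ≤ n
    kL≤ = ≤-trans (+-monoʳ-≤ (proj₁ d) (m≤m+n l _)) k≤
    kR≤ : proj₁ (traverse q c L d) + r ≤ n
    kR≤ = ≤-trans (+-monoˡ-≤ r (traverse-≤ q c L d))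
      (≤-trans (n≤1+n _) (≤-trans (≤-reflexive (lemma (proj₁ d) l r)) k≤))
      where
      lemma : ∀ k a b → suc (k + a + b) ≡ k + (a + suc b)
      lemma = solve-∀

  -- Once the stack is empty, the return code reads the blank cell at `stride` as a leaf number; the
  -- value 0 sends it to 34.
  pass : ∀ {T p as} → Stores M₀ T p as → All (_≤ 4 * n) as → #nodes T ≡ n →
         ∀ q {c} d ρ {M} → ρ 0 ≡ p → Regs q (suc stride) c (proj₁ d) ρ → proj₁ d ≡ 0 →
         Mem (proj₂ d) M → M stride ≡ 0 →
         ∃₂ λ ρ′ M′ → ∃[ c′ ] (state 6 ρ M ↝[ 1 + (time T + 3) ] state 34 ρ′ M′ ×
                      Regs q (suc stride) c′ (proj₁ (traverse q 2 T d)) ρ′ ×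
                      Mem (proj₂ (traverse q 2 T d)) M′ × M′ stride ≡ 0)
  pass {T} s as≤ refl q d ρ r0 (r1 , r2 , r3 , r4 , r5 , r6 , r7 , r8) d≡0 m M-stride =
    let ρ₁ , M₁ , run₁ , (s1 , s2 , s3 , s4 , s5 , s6 , s7 , s8) , m₁ , agree =
          visit s as≤ q d (ρ [ 4 ↦ 2 ]) r0 (r1 , r2 , r3 , refl , r5 , r6 , r7 , r8) m
            ≤-refl sp≤ ≤-refl ≤-refl (≤-reflexive (cong (_+ n) d≡0))
        M₁-stride = trans (agree ≤-refl) M-stride
    in _ , _ , _ ,
       ( run-set refl (fits 2≤limit)
       » run₁
       » run-arith refl (cong₂ _∸_ s3 s7) (fits stride≤limit)
       » run-load refl refl M₁-stride
       » run-jzero refl refl ) ,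
       (s1 , s2 , s3 , s4 , s5 , s6 , s7 , s8) , m₁ , M₁-stride
    where
    2≤limit : 2 ≤ limit
    2≤limit = ≤-trans (s≤s (s≤s z≤n)) 3+n≤limit
    sp≤ : suc stride + 2 * n ≤ 2 * stride
    sp≤ = ≤-trans (m≤m+n _ (3 + 2 * n)) (≤-reflexive (lemma n))
      where
      lemma : ∀ n → suc (4 * suc n) + 2 * n + (3 + 2 * n) ≡ 2 * (4 * suc n)
      lemma = solve-∀

  setup : ∀ p q → ∃[ ρ ] (state 0 (initialRegs n p q) M₀ ↝[ 6 ] state 6 ρ M₀ ×
                          ρ 0 ≡ p × Regs q (suc stride) 0 0 ρ)
  setup p q = _ ,
    ( run-set refl (fits (≤-trans (s≤s z≤n) 4≤limit))
    » run-set refl (fits 4≤limit)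
    » run-arith refl refl (fits (≤-trans (≤-reflexive (*-comm n 4)) 4*n≤limit))
    » run-set refl (fits 4≤limit)
    » run-arith refl n*4+4 (fits stride≤limit)
    » run-arith refl (+-comm stride 1) (fits 1+stride≤limit) ) ,
    refl , (refl , refl , refl , refl , refl , refl , refl , refl)
    where
    4≤limit : 4 ≤ limit
    4≤limit = ≤-trans (m≤m*n 4 (suc n)) stride≤limit
    1+stride≤limit : suc stride ≤ limit
    1+stride≤limit = m≤m+n (suc stride) _
    n*4+4 : n * 4 + 4 ≡ stride
    n*4+4 = lemma n
      where
      lemma : ∀ n → n * 4 + 4 ≡ 4 * suc n
      lemma = solve-∀

  -- Clearing register 1 switches from recording to counting, and makes the next arrival at 34
  -- proceed to the output.
  next-tree : ∀ {q sp c k} ρ {M} → Regs (suc q) sp c k ρ → suc q ≤ 4 * n →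
              ∃[ ρ′ ] (state 34 ρ M ↝[ 4 ] state 6 ρ′ M × ρ′ 0 ≡ suc q × Regs 0 sp c k ρ′)
  next-tree {q} ρ (r1 , r2 , r3 , r4 , r5 , r6 , r7 , r8) q≤ = _ ,
    ( run-jnonzero refl (subst (0 <_) (sym r1) (s≤s z≤n))
    » run-arith refl (trans (cong₂ _+_ r1 r8) (+-identityʳ (suc q)))
        (fits (≤-trans q≤ 4*n≤limit))
    » run-set refl (fits z≤n)
    » run-jump refl ) ,
    refl , (refl , r2 , r3 , r4 , r5 , r6 , r7 , r8)

  output : ∀ {sp c k} ρ {M} → Regs 0 sp c k ρ →
           ∃[ ρ′ ] (state 34 ρ M ↝[ 3 ] state 40 ρ′ M × ρ′ 0 ≡ 2 * (n ∸ k))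
  output {k = k} ρ (r1 , r2 , _ , _ , r5 , _) = _ ,
    ( run-jzero refl r1
    » run-arith refl (cong₂ _∸_ r2 r5)
        (fits (≤-trans (m∸n≤m n k) (m+n≤o⇒n≤o 3 3+n≤limit)))
    » run-arith refl (cong (n ∸ k +_) (sym (+-identityʳ (n ∸ k))))
        (fits (≤-trans (*-mono-≤ {2} {4} (s≤s (s≤s z≤n)) (m∸n≤m n k)) 4*n≤limit)) ) ,
    refl

  -- The complete run

  module _ {S T p q} (inp : Input n S T M₀ p q) (#S : #nodes S ≡ n) (#T : #nodes T ≡ n) where

    open Input inp

    storesS≤ : All (_≤ 4 * n) cellsS
    storesS≤ = proj₁ (All.++⁻ cellsS packed)

    storesT≤ : All (_≤ 4 * n) cellsT
    storesT≤ = proj₂ (All.++⁻ cellsS packed)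

    blank-above : ∀ {a} → 4 * n < a → M₀ a ≡ 0
    blank-above <a = blank _ λ a∈ → <⇒≱ <a (All.lookup packed a∈)

    mem₀ : Mem [] M₀
    mem₀ .input _       = refl
    mem₀ .table {b = b} 2≤a _ = blank-above (<-≤-trans 4*n<stride
      (≤-trans (m≤m+n stride _) (2*stride≤key b 2≤a)))

    -- 49 here and 39 in `time-two` are the time left on reaching the final `halt`, which takes one
    -- unit of it.
    time-one : n ≡ 0 → 64 * suc n ≡ 6 + ((1 + (time S + 3)) + 3) + 49
    time-one n≡0 rewrite time≡ S | #S | n≡0 = refl

    time-two : 64 * suc n ≡ 6 + ((1 + (time S + 3)) + (4 + ((1 + (time T + 3)) + 3))) + 39
    time-two rewrite time≡ S | time≡ T | #S | #T = lemma n
      where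
      lemma : ∀ n → 64 * suc n ≡
        6 + ((1 + (32 * n + 2 + 3)) + (4 + ((1 + (32 * n + 2 + 3)) + 3))) + 39
      lemma = solve-∀

    exec-program : ∃[ A ] (exec w program (64 * suc n) (initial n M₀ p q) ≡ just A ×
                           A ≡ 2 * (n ∸ #kept (_∈? spans 2 S) (spans 2 T)))
    exec-program = cases storesT storesT≤ refl refl
      where
      ρ₀ = proj₁ (setup p q)
      halts : ∀ {k t ρ M} → initial n M₀ p q ↝[ k ] state 40 ρ M → 64 * suc n ≡ k + suc t →
              exec w program (64 * suc n) (initial n M₀ p q) ≡ just (ρ 0)
      halts {t = t} (run r) eq =
        trans (cong (λ u → exec w program u (initial n M₀ p q)) eq) (r (suc t))
      cases : ∀ {T′ q′ as} → Stores M₀ T′ q′ as → All (_≤ 4 * n) as → T′ ≡ T → q′ ≡ q →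
        ∃[ A ] (exec w program (64 * suc n) (initial n M₀ p q) ≡ just A ×
                A ≡ 2 * (n ∸ #kept (_∈? spans 2 S) (spans 2 T)))
      -- Here `n` is 0 and `q` is null, so register 1 is 0 from the start: there is a single pass,
      -- over `S`, and `n ∸ k` vanishes for every `k`.
      cases leaf _ refl refl =
        let ρ₁ , run₁ , r0₁ , regs₁ = setup p 0
            ρ₂ , M₂ , _ , run₂ , regs₂ , _ =
              pass storesS storesS≤ #S 0 (0 , []) ρ₁ r0₁ regs₁ refl mem₀ (blank-above 4*n<stride)
            ρ₃ , run₃ , r0₃ = output ρ₂ regs₂
        in _ , halts {t = 48} (run₁ » run₂ » run₃) (time-one (sym #T)) ,
           trans r0₃ (cong (2 *_) (trans (n∸ (proj₁ (traverse 0 2 S (0 , [])))) (sym (n∸ 0))))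
        where
        n∸ : ∀ k → n ∸ k ≡ 0
        n∸ k = trans (cong (_∸ k) (sym #T)) (0∸n≡0 k)
      cases {q′ = suc q′} sT@(node {as = as} {bs = bs} 0<q _ _) (q≤ ∷ as≤) refl refl =
        let d₁ = traverse (suc q′) 2 S (0 , [])
            ρ₁ , run₁ , r0₁ , regs₁ = setup p (suc q′)
            ρ₂ , M₂ , _ , run₂ , regs₂ , m₂ , M₂-stride =
              pass storesS storesS≤ #S (suc q′) (0 , []) ρ₁ r0₁ regs₁ refl mem₀
                (blank-above 4*n<stride)
            ρ₃ , run₃ , r0₃ , regs₃ = next-tree ρ₂ {M₂} regs₂ q≤
            ρ₄ , M₄ , _ , run₄ , regs₄ , _ =
              pass sT (q≤ ∷ as≤) #T 0 d₁ ρ₃ r0₃ regs₃ (cong proj₁ recorded) m₂ M₂-stride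
            ρ₅ , run₅ , r0₅ = output ρ₄ regs₄
        in _ , halts {t = 38} (run₁ » run₂ » run₃ » run₄ » run₅) time-two ,
           trans r0₅ (cong (λ k → 2 * (n ∸ k)) counted)
        where
        recorded : traverse (suc q′) 2 S (0 , []) ≡ (0 , spans 2 S)
        recorded = trans (traverse-record q′ 2 S 0 []) (cong (0 ,_) (++-identityʳ (spans 2 S)))
        counted : proj₁ (traverse 0 2 T (traverse (suc q′) 2 S (0 , []))) ≡
                  #kept (_∈? spans 2 S) (spans 2 T)
        counted = trans (cong (λ d → proj₁ (traverse 0 2 T d)) recorded)
                        (cong proj₁ (traverse-count 2 T 0 (spans 2 S)))

corollary2 : ∃[ P ] ∃[ k ] ∃[ c ]
    (∀ (n : ℕ) (S T : BinTree) → #nodes S ≡ n → #nodes T ≡ n →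
    ∀ (M : Memory) (p q : Address) → Input n S T M p q →
    ∃[ A ] (exec (wordSize k n) P (c * suc n) (initial n M p q) ≡ just A
    × ∃[ d ] (IsRotationDistance S T d × d ≤ A × A ≤ 2 * d)))
-- 64 stems from 32 instructions per node in each of two traversals; the constant overhead fits into
-- the extra 64 of `64 * suc n`. The span lemmas are applied with 2, the machine's first leaf
-- number.
corollary2 = program , 2 , 64 , λ n S T #S #T M p q inp →
  let A , halts , A≡ = Correctness.exec-program n (wordSize 2 n) (Layout.limit-fits n) M inp #S #T
      d , isDistance , d≤ , ≤2d = rotationDistance-bounds 2 S T (trans #S (sym #T))
      bound≡A = trans (cong (λ m → 2 * (m ∸ #kept (_∈? spans 2 S) (spans 2 T))) #T) (sym A≡)
  in A , halts , d , isDistance , subst (d ≤_) bound≡A d≤ , subst (_≤ 2 * d) bound≡A ≤2d
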